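{- For all integers $n\geq 0$, $c_{10}(n)\equiv 1 \pmod 2$ if $n=2j^{2}+j$ for some $j\in\mathbb{Z}$, and $c_{10}(n)\equiv 0 \pmod 2$ otherwise.
   Context: A partition of $n$ is a finite non-increasing sequence of positive integers (its parts) summing to $n$. Let $c_{10}(n)$ be the number of partitions of $n$ in which either (a) all parts are distinct, or (b) there is an integer $j\geq 1$ such that every positive integer $\le j$ appears as a part, the odd integers $\leq j$ appear two or three times, the even integers $\leq j$ appear exactly twice, odd parts greater than $j$ are distinct, no even integer $e$ with $j<e\leq 2j$ appears as a part, and even parts greater than $2j$ are distinct. Equivalently, $\sum_{n\ge0}c_{10}(n)q^n=\sum_{j\ge0}q^{j(j+1)}\prod_{i\ge1}(1+q^{2j+2i})\prod_{i\ge1}(1+q^{2i-1})$. -}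

module Defs where

open import Data.Nat using (ℕ; _+_; _*_; _≤_; _<_; _%_)
open import Data.Nat.Properties using (_≟_)
open import Data.Nat.ListAction using (sum)
open import Data.Integer as ℤ using (ℤ; +_)
open import Data.List using (List; length; filter)
open import Data.List.Relation.Unary.All using (All)
open import Data.List.Relation.Unary.Linked using (Linked)
open import Data.List.Relation.Unary.Unique.Propositional using (Unique)
open import Data.List.Membership.Propositional using (_∈_; _∉_)
open import Data.Product using (Σ; _×_; ∃)
open import Data.Sum using (_⊎_)
open import Relation.Binary.PropositionalEquality using (_≡_)
open import Function.Bundles using (_⇔_)
open import Relation.Nullary using (¬_)

IsPartition : ℕ → List ℕ → Set
IsPartition n ps = All (λ x → 1 ≤ x) ps × Linked (λ a b → b ≤ a) ps × sum ps ≡ n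

mult : ℕ → List ℕ → ℕ
mult i ps = length (filter (i ≟_) ps)

Odd Even : ℕ → Set
Odd m = m % 2 ≡ 1
Even m = m % 2 ≡ 0

CondB : ℕ → List ℕ → Set
CondB j ps =
  1 ≤ j ×
  (∀ i → 1 ≤ i → i ≤ j →
     (Odd i → (mult i ps ≡ 2 ⊎ mult i ps ≡ 3)) × (Even i → mult i ps ≡ 2)) ×
  (∀ p → Odd p → j < p → mult p ps ≤ 1) ×
  (∀ e → Even e → j < e → e ≤ 2 * j → e ∉ ps) ×
  (∀ e → Even e → 2 * j < e → mult e ps ≤ 1)

C10 : List ℕ → Set
C10 ps = Unique ps ⊎ ∃ λ j → CondB j ps

-- L is a duplicate-free list of exactly the partitions of n counted by c₁₀;
-- hence c₁₀(n) = length L.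
C10List : ℕ → List (List ℕ) → Set
C10List n L = Unique L × (∀ ps → (ps ∈ L) ⇔ (IsPartition n ps × C10 ps))

IsGenPent : ℕ → Set
IsGenPent n = ∃ λ (j : ℤ) → + n ≡ (+ 2) ℤ.* j ℤ.* j ℤ.+ j

{-# OPTIONS --safe #-}
-- Splitting off j(j+1) = 2(1 + ⋯ + j) turns the count into Σ_j q^{j(j+1)} ∏_{i>j}(1+q²ⁱ) · O with
-- O = ∏(1+q²ⁱ⁻¹).  Put E = ∏(1+q²ⁱ) and compute in F₂[[q]]/(qⁿ⁺¹).  The functional equation
-- W(y) = (1 + y q²) W(y q²) of W(y) = Σ_j yʲ q^{j(j+1)} ∏_{i>j}(1+q²ⁱ) gives W(1) = E², so the
-- count is O E².  Gauss's identity, by Shanks' finite form, says O · Σ_k q^{k(k+1)/2} = E, while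
-- (O E)² = ∏(1+q²ⁱ) = E by Frobenius.  Cancelling the unit O leaves O E² = Σ_k q^{k(k+1)/2}, and
-- the numbers 2j² + j (j ∈ ℤ) are exactly the triangular numbers.
module Submission where

open import Defs
open import Algebra.Bundles using (CommutativeRing)
import Algebra.Properties.CommutativeSemiring.Exp
import Algebra.Properties.Ring
import Algebra.Properties.Semiring.Exp
import Algebra.Solver.Ring
open import Algebra.Solver.Ring.AlmostCommutativeRing
  using (_-Raw-AlmostCommutative⟶_; Induced-equivalence; fromCommutativeRing)
open import Data.Bool using (Bool; true; false; _∧_; _∨_; _xor_; not; if_then_else_)
open import Data.Bool.Properties
  using (T-≡; ¬-not; not-involutive; not-distribˡ-xor; xor-assoc; xor-comm; xor-same; xor-identityʳ;
         ∧-assoc; ∧-comm; ∧-distribˡ-xor; ∧-distribʳ-xor; xor-∧-commutativeRing)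
open import Data.Integer as ℤ using (-[1+_])
import Data.Integer.Properties as ℤ
open import Data.List
  using (List; []; _∷_; _++_; length; map; concatMap; foldr; replicate; filter; downFrom)
open import Data.List.Membership.Propositional using (_∈_; _∉_; find; lose)
open import Data.List.Membership.Propositional.Properties
  using (∈-map⁺; ∈-map⁻; ∈-concatMap⁺; ∈-concatMap⁻; ∈-downFrom⁺; ∈-downFrom⁻)
open import Data.List.Properties
  using (length-++; length-map; length-replicate; filter-++; filter-all; filter-none;
         filter-accept; filter-reject; ++-cancelˡ)
open import Data.List.Relation.Binary.Disjoint.Propositional using (Disjoint)
open import Data.List.Relation.Unary.All as All using (All; []; _∷_)
import Data.List.Relation.Unary.All.Properties as All
open import Data.List.Relation.Unary.AllPairs as AllPairs using (AllPairs; []; _∷_)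
import Data.List.Relation.Unary.AllPairs.Properties as AllPairs
open import Data.List.Relation.Unary.Any using (here; there)
open import Data.List.Relation.Unary.Linked as Linked using (Linked; []; [-]; _∷_)
open import Data.List.Relation.Unary.Linked.Properties using (Linked⇒All)
open import Data.List.Relation.Unary.Unique.Propositional using (Unique)
import Data.List.Relation.Unary.Unique.Propositional.Properties as Unique
open import Data.Maybe using (just; nothing)
open import Data.Nat as ℕ using (ℕ; zero; suc; _≤_; _<_; _%_; z≤n; s≤s)
open import Data.Nat.ListAction using (sum)
open import Data.Nat.ListAction.Properties using (sum-++)
import Data.Nat.Properties as ℕ
open import Data.Nat.Solver using (module +-*-Solver)
open import Data.Product using (Σ; ∃; ∃₂; _×_; _,_; proj₁; proj₂)
open import Data.Sum using (_⊎_; inj₁; inj₂)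
open import Function using (_∘_; id)
open import Function.Bundles using (Equivalence; _⇔_; mk⇔)
open import Relation.Binary.PropositionalEquality as ≡
  using (_≡_; _≢_; cong; cong₂; subst; module ≡-Reasoning)
open import Relation.Binary.Definitions using (WeaklyDecidable)
import Relation.Binary.Reasoning.Setoid
open import Relation.Nullary using (¬_; contradiction; does; yes; no)
open import Relation.Nullary.Decidable using (dec-true; dec-false; does-⇔)

-- Algebra in characteristic two

-- Truncation removes every question of convergence. The algebra takes place in an arbitrary
-- commutative ring of characteristic two, with q^(N+1) = 0 assumed only where a limit would be
-- taken. The functional equations are proved for finite sums, where each fails by one explicit
-- monomial or product, and nilpotency then removes that defect. Characteristic two does more than
-- allow Frobenius: it identifies 1 + x with 1 - x. Gauss's series, classically ∏ (1 - q²ⁱ) / (1 -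
-- q²ⁱ⁻¹), thus involves the same products O and E as the count of partitions. On the combinatorial
-- side the partitions are listed by a recursion on the largest part that mirrors the recursion of
-- the finite product, so the parity of the length of the list is a coefficient. This needs the
-- cases for different j to be disjoint, since otherwise the sum over j would count a partition
-- twice.

tri : ℕ → ℕ
tri zero    = zero
tri (suc k) = suc k ℕ.+ tri k

tri-*2 : ∀ j → tri j ℕ.* 2 ≡ j ℕ.* suc j
tri-*2 zero    = ≡.refl
tri-*2 (suc j) = ≡.trans (≡.trans (ℕ.*-distribʳ-+ 2 (suc j) (tri j))
  (cong (suc j ℕ.* 2 ℕ.+_) (tri-*2 j)))
  (solve 1 (λ j → (con 1 :+ j) :* con 2 :+ j :* (con 1 :+ j) := (con 1 :+ j) :* (con 2 :+ j)) ≡.refl j)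
  where open +-*-Solver

-- With `tri-odd` this makes q^(tri k) a power of q^(2s+1) for both k = 2s and k = 2s + 1, as
-- `shanks` requires. The same factorisations identify the values of 2j² + j.
tri-even : ∀ s → tri (s ℕ.* 2) ≡ suc (s ℕ.* 2) ℕ.* s
tri-even s = ℕ.*-cancelʳ-≡ _ _ 2 (≡.trans (tri-*2 (s ℕ.* 2))
  (solve 1 (λ s → s :* con 2 :* (con 1 :+ s :* con 2) := (con 1 :+ s :* con 2) :* s :* con 2) ≡.refl s))
  where open +-*-Solver

tri-odd : ∀ s → tri (suc (s ℕ.* 2)) ≡ suc (s ℕ.* 2) ℕ.* suc s
tri-odd s = ≡.trans (cong (suc (s ℕ.* 2) ℕ.+_) (tri-even s))
  (≡.sym (ℕ.*-suc (suc (s ℕ.* 2)) s))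

double : ∀ n → n ℕ.* 2 ≡ n ℕ.+ n
double n = ≡.trans (ℕ.*-comm n 2) (cong (n ℕ.+_) (ℕ.+-identityʳ n))

odd-1+2* : ∀ l → Odd (suc (l ℕ.* 2))
odd-1+2* zero    = ≡.refl
odd-1+2* (suc l) = odd-1+2* l

even-2* : ∀ l → Even (l ℕ.* 2)
even-2* zero    = ≡.refl
even-2* (suc l) = even-2* l

even⇒¬odd : ∀ {i} → Even i → ¬ Odd i
even⇒¬odd even odd with () ← ≡.trans (≡.sym even) odd

-- A partition belongs to case (b) with parameter j (to case (a) if j = 0) iff each i ≥ 1 has
-- multiplicity base j i, or base j i + 1 when i is free.
base : ℕ → ℕ → ℕ
base j i = if does (i ℕ.≤? j) then 2 else 0

-- Even i ≤ 2j are never free, whether they are forced (i ≤ j) or missing (j < i ≤ 2j), and odd i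
-- are free on both sides of j. Hence the threshold j matters only for `base` and the threshold 2j
-- only for `free`.
free : ℕ → ℕ → Bool
free j i = does (i ℕ.% 2 ℕ.≟ 1) ∨ does (2 ℕ.* j ℕ.<? i)

allowed : ℕ → ℕ → List ℕ
allowed j i = if free j i then base j i ∷ suc (base j i) ∷ [] else base j i ∷ []

base-≤ : ∀ {j i} → i ℕ.≤ j → base j i ≡ 2
base-≤ {j} {i} i≤j = cong (if_then 2 else 0) (dec-true (i ℕ.≤? j) i≤j)

base-> : ∀ {j i} → j ℕ.< i → base j i ≡ 0
base-> {j} {i} j<i = cong (if_then 2 else 0) (dec-false (i ℕ.≤? j) (ℕ.<⇒≱ j<i))

free-odd : ∀ j i → Odd i → free j i ≡ true
free-odd j i odd = cong (_∨ does (2 ℕ.* j ℕ.<? i)) (dec-true (i ℕ.% 2 ℕ.≟ 1) odd)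

free-even : ∀ j i → Even i → free j i ≡ does (2 ℕ.* j ℕ.<? i)
free-even j i even = cong (_∨ does (2 ℕ.* j ℕ.<? i))
  (dec-false (i ℕ.% 2 ℕ.≟ 1) (even⇒¬odd {i} even))

free-double : ∀ j l → free j (l ℕ.* 2) ≡ does (j ℕ.<? l)
free-double j l = ≡.trans (free-even j (l ℕ.* 2) (even-2* l)) (does-⇔ (mk⇔
  (λ lt → ℕ.*-cancelˡ-< 2 j l (subst (2 ℕ.* j ℕ.<_) (ℕ.*-comm l 2) lt))
  (λ lt → subst (2 ℕ.* j ℕ.<_) (ℕ.*-comm 2 l) (ℕ.*-monoʳ-< 2 lt)))
  (2 ℕ.* j ℕ.<? l ℕ.* 2) (j ℕ.<? l))

1+1≈0 : ∀ {c ℓ} → CommutativeRing c ℓ → Set ℓ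
1+1≈0 R = 1# + 1# ≈ 0#
  where open CommutativeRing R

module CharacteristicTwo {c ℓ} (R : CommutativeRing c ℓ) (char2 : 1+1≈0 R) where

  open CommutativeRing R
  open Algebra.Properties.CommutativeSemiring.Exp commutativeSemiring
  open Algebra.Properties.Ring ring using (-0#≈0#)
  open Relation.Binary.Reasoning.Setoid setoid

  -1≈1 : - 1# ≈ 1#
  -1≈1 = sym (begin
    1#                 ≈⟨ +-identityʳ 1# ⟨
    1# + 0#            ≈⟨ +-congˡ (-‿inverseʳ 1#) ⟨
    1# + (1# + - 1#)   ≈⟨ +-assoc 1# 1# (- 1#) ⟨
    1# + 1# + - 1#     ≈⟨ +-congʳ char2 ⟩
    0# + - 1#          ≈⟨ +-identityˡ (- 1#) ⟩
    - 1#               ∎)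

  -- Coefficients in F₂ let the solver use char2.
  F₂⟶R : CommutativeRing.rawRing xor-∧-commutativeRing -Raw-AlmostCommutative⟶ fromCommutativeRing R
  F₂⟶R = record
    { ⟦_⟧    = λ b → if b then 1# else 0#
    ; +-homo = λ where
        true  true  → sym char2
        true  false → sym (+-identityʳ 1#)
        false _     → sym (+-identityˡ _)
    ; *-homo = λ where
        true  _ → sym (*-identityˡ _)
        false _ → sym (zeroˡ _)
    ; -‿homo = λ where
        true  → sym -1≈1
        false → sym -0#≈0#
    ; 0-homo = refl
    ; 1-homo = refl
    }

  coefficient≟ : WeaklyDecidable (Induced-equivalence F₂⟶R)
  coefficient≟ true  true  = just refl
  coefficient≟ false false = just refl
  coefficient≟ _     _     = nothing

  open Algebra.Solver.Ring (CommutativeRing.rawRing xor-∧-commutativeRing)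
    (fromCommutativeRing R) F₂⟶R coefficient≟

  :1 : ∀ {n} → Polynomial n
  :1 = con true

  -- Finite products and units

  ∏ : (ℕ → Carrier) → ℕ → Carrier
  ∏ f zero    = 1#
  ∏ f (suc k) = f k * ∏ f k

  ∏-cong : ∀ {f g} → (∀ i → f i ≈ g i) → ∀ k → ∏ f k ≈ ∏ g k
  ∏-cong f≈g zero    = refl
  ∏-cong f≈g (suc k) = *-cong (f≈g k) (∏-cong f≈g k)

  ∏-* : ∀ f g k → ∏ (λ i → f i * g i) k ≈ ∏ f k * ∏ g k
  ∏-* f g zero    = sym (*-identityˡ 1#)
  ∏-* f g (suc k) = trans (*-congˡ (∏-* f g k))
    (solve 4 (λ a b c d → (a :* b) :* (c :* d) := (a :* c) :* (b :* d)) refl _ _ _ _)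

  -- Index i will stand for the part i + 1, so the even indices carry the odd parts and the odd
  -- indices the even parts.
  ∏-pair : ∀ f k → ∏ f (k ℕ.* 2) ≈ ∏ (λ i → f (i ℕ.* 2)) k * ∏ (λ i → f (suc (i ℕ.* 2))) k
  ∏-pair f zero    = sym (*-identityˡ 1#)
  ∏-pair f (suc k) = trans (*-congˡ (*-congˡ (∏-pair f k)))
    (solve 4 (λ a b c d → a :* (b :* (c :* d)) := (b :* c) :* (a :* d)) refl _ _ _ _)

  ∏-stable : ∀ f k → (∀ i → k ℕ.≤ i → f i ≈ 1#) → ∀ d → ∏ f (d ℕ.+ k) ≈ ∏ f k
  ∏-stable f k f≈1 zero    = refl
  ∏-stable f k f≈1 (suc d) = begin
    f (d ℕ.+ k) * ∏ f (d ℕ.+ k) ≈⟨ *-cong (f≈1 _ (ℕ.m≤n+m k d)) (∏-stable f k f≈1 d) ⟩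
    1# * ∏ f k                  ≈⟨ *-identityˡ _ ⟩
    ∏ f k                       ∎

  Invertible : Carrier → Set _
  Invertible x = ∃ λ y → x * y ≈ 1#

  ∏-invertible : ∀ f → (∀ i → Invertible (f i)) → ∀ k → Invertible (∏ f k)
  ∏-invertible f inv zero    = 1# , *-identityˡ 1#
  ∏-invertible f inv (suc k) with inv k | ∏-invertible f inv k
  ... | u , fu≈1 | v , pv≈1 = u * v , (begin
    (f k * ∏ f k) * (u * v)
      ≈⟨ solve 4 (λ a b c d → (a :* b) :* (c :* d) := (a :* c) :* (b :* d)) refl _ _ _ _ ⟩
    (f k * u) * (∏ f k * v) ≈⟨ *-cong fu≈1 pv≈1 ⟩
    1# * 1#                 ≈⟨ *-identityˡ 1# ⟩
    1#                      ∎)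

  *-cancelˡ-invertible : ∀ {a x y} → Invertible a → a * x ≈ a * y → x ≈ y
  *-cancelˡ-invertible {a} {x} {y} (b , ab≈1) ax≈ay = begin
    x           ≈⟨ *-identityˡ x ⟨
    1# * x      ≈⟨ *-congʳ ab≈1 ⟨
    a * b * x   ≈⟨ swap a b x ⟩
    b * (a * x) ≈⟨ *-congˡ ax≈ay ⟩
    b * (a * y) ≈⟨ swap a b y ⟨
    a * b * y   ≈⟨ *-congʳ ab≈1 ⟩
    1# * y      ≈⟨ *-identityˡ y ⟩
    y           ∎
    where
    swap : ∀ a b x → a * b * x ≈ b * (a * x)
    swap = solve 3 (λ a b x → a :* b :* x := b :* (a :* x)) refl

  geometric : Carrier → ℕ → Carrier
  geometric x zero    = 1#
  geometric x (suc k) = 1# + x * geometric x k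

  [1+x]*geometric : ∀ x k → (1# + x) * geometric x k ≈ 1# + x ^ suc k
  [1+x]*geometric x zero    = solve 1 (λ x → (:1 :+ x) :* :1 := :1 :+ x :* :1) refl x
  [1+x]*geometric x (suc k) = begin
    (1# + x) * (1# + x * geometric x k)
      ≈⟨ solve 2 (λ x g → (:1 :+ x) :* (:1 :+ x :* g) := :1 :+ x :+ x :* ((:1 :+ x) :* g)) refl _ _ ⟩
    1# + x + x * ((1# + x) * geometric x k) ≈⟨ +-congˡ (*-congˡ ([1+x]*geometric x k)) ⟩
    1# + x + x * (1# + x ^ suc k)
      ≈⟨ solve 2 (λ x p → :1 :+ x :+ x :* (:1 :+ p) := :1 :+ x :* p) refl _ _ ⟩
    1# + x ^ suc (suc k) ∎

  -- The geometric sum telescopes without signs in characteristic two, and its remainder x^(k+1)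
  -- vanishes.
  1+nilpotent-invertible : ∀ x k → x ^ suc k ≈ 0# → Invertible (1# + x)
  1+nilpotent-invertible x k x^≈0 = geometric x k , (begin
    (1# + x) * geometric x k ≈⟨ [1+x]*geometric x k ⟩
    1# + x ^ suc k           ≈⟨ +-congˡ x^≈0 ⟩
    1# + 0#                  ≈⟨ +-identityʳ 1# ⟩
    1#                       ∎)

  ^-vanishes : ∀ {x m n} → x ^ m ≈ 0# → m ℕ.≤ n → x ^ n ≈ 0#
  ^-vanishes {x} {m} {n} x^m≈0 m≤n = begin
    x ^ n                     ≡⟨ cong (x ^_) (ℕ.m+[n∸m]≡n m≤n) ⟨
    x ^ (m ℕ.+ (n ℕ.∸ m))     ≈⟨ ^-homo-* x m _ ⟩
    x ^ m * x ^ (n ℕ.∸ m)     ≈⟨ *-congʳ x^m≈0 ⟩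
    0# * x ^ (n ℕ.∸ m)        ≈⟨ zeroˡ _ ⟩
    0#                        ∎

  1^n≈1 : ∀ n → 1# ^ n ≈ 1#
  1^n≈1 zero    = refl
  1^n≈1 (suc n) = trans (*-identityˡ _) (1^n≈1 n)

  -- The sum over j and its functional equation

  qPochhammer : Carrier → ℕ → Carrier
  qPochhammer q = ∏ (λ i → 1# + q ^ suc i)

  -- W r y k = Σ_{j≤k} yʲ r^{tri j} ∏_{j<i≤k} (1 + rⁱ).
  W : Carrier → Carrier → ℕ → Carrier
  W r y zero    = 1#
  W r y (suc k) = (1# + r ^ suc k) * W r y k + y ^ suc k * r ^ tri (suc k)

  W-cong : ∀ r {y z} → y ≈ z → ∀ k → W r y k ≈ W r z k
  W-cong r y≈z zero    = refl
  W-cong r y≈z (suc k) = +-cong (*-congˡ (W-cong r y≈z k)) (*-congʳ (^-congˡ (suc k) y≈z))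

  W-0 : ∀ r k → W r 0# k ≈ qPochhammer r k
  W-0 r zero    = refl
  W-0 r (suc k) = begin
    (1# + r ^ suc k) * W r 0# k + 0# * 0# ^ k * r ^ tri (suc k)
      ≈⟨ +-cong (*-congˡ (W-0 r k)) (trans (*-assoc _ _ _) (zeroˡ _)) ⟩
    (1# + r ^ suc k) * qPochhammer r k + 0# ≈⟨ +-identityʳ _ ⟩
    (1# + r ^ suc k) * qPochhammer r k ∎

  -- Truncation at `k` breaks W(y) = (1 + y r) W(y r) by a single monomial, and the recursion in `k`
  -- turns this monomial into the next one. Its exponent of r is at least k + 1, so the equation
  -- becomes exact as soon as r^(k+1) vanishes.
  W-shift : ∀ r y k → W r y k + (1# + y * r) * W r (y * r) k ≈ y ^ suc k * r ^ tri (suc k)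
  W-shift r y zero = solve 2 (λ r y → :1 :+ (:1 :+ y :* r) :* :1 := y :* :1 :* (r :* :1)) refl r y
  W-shift r y (suc k) = begin
    (1# + a) * w + b * t + (1# + y * r) * ((1# + a) * w′ + (y * r) ^ suc k * t)
      ≈⟨ +-congˡ (*-congˡ (+-congˡ (*-congʳ (^-distrib-* y r (suc k))))) ⟩
    (1# + a) * w + b * t + (1# + y * r) * ((1# + a) * w′ + b * a * t)
      ≈⟨ solve 7 (λ r y a b t w w′ →
           (:1 :+ a) :* w :+ b :* t :+ (:1 :+ y :* r) :* ((:1 :+ a) :* w′ :+ b :* a :* t)
           := (:1 :+ a) :* (w :+ (:1 :+ y :* r) :* w′) :+ (:1 :+ (:1 :+ y :* r) :* a) :* (b :* t))
           refl r y a b t w w′ ⟩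
    (1# + a) * (w + (1# + y * r) * w′) + (1# + (1# + y * r) * a) * (b * t)
      ≈⟨ +-congʳ (*-congˡ (W-shift r y k)) ⟩
    (1# + a) * (b * t) + (1# + (1# + y * r) * a) * (b * t)
      ≈⟨ solve 5 (λ r y a b t →
           (:1 :+ a) :* (b :* t) :+ (:1 :+ (:1 :+ y :* r) :* a) :* (b :* t)
           := y :* b :* (r :* a :* t)) refl r y a b t ⟩
    y ^ suc (suc k) * (r * a * t)
      ≈⟨ *-congˡ (sym (^-homo-* r (suc (suc k)) (tri (suc k)))) ⟩
    y ^ suc (suc k) * r ^ tri (suc (suc k)) ∎
    where
    a = r ^ suc k
    b = y ^ suc k
    t = r ^ tri (suc k)
    w = W r y k
    w′ = W r (y * r) k

  x+y≈0⇒x≈y : ∀ {x y} → x + y ≈ 0# → x ≈ y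
  x+y≈0⇒x≈y {x} {y} x+y≈0 = begin
    x         ≈⟨ solve 2 (λ x y → x := x :+ y :+ y) refl x y ⟩
    x + y + y ≈⟨ +-congʳ x+y≈0 ⟩
    0# + y    ≈⟨ +-identityˡ y ⟩
    y         ∎

  W-step : ∀ r N → r ^ suc N ≈ 0# → ∀ y → W r y N ≈ (1# + y * r) * W r (y * r) N
  W-step r N r^≈0 y = x+y≈0⇒x≈y (begin
    W r y N + (1# + y * r) * W r (y * r) N ≈⟨ W-shift r y N ⟩
    y ^ suc N * r ^ tri (suc N) ≈⟨ *-congˡ (^-vanishes r^≈0 (ℕ.m≤m+n (suc N) (tri N))) ⟩
    y ^ suc N * 0#              ≈⟨ zeroʳ _ ⟩
    0#                          ∎)

  W-iterate : ∀ r N → r ^ suc N ≈ 0# → ∀ m → W r 1# N ≈ qPochhammer r m * W r (r ^ m) N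
  W-iterate r N r^≈0 zero    = sym (*-identityˡ _)
  W-iterate r N r^≈0 (suc m) = begin
    W r 1# N                                         ≈⟨ W-iterate r N r^≈0 m ⟩
    p * W r (r ^ m) N                                ≈⟨ *-congˡ (W-step r N r^≈0 (r ^ m)) ⟩
    p * ((1# + r ^ m * r) * W r (r ^ m * r) N)
      ≈⟨ *-congˡ (*-cong (+-congˡ (*-comm _ _)) (W-cong r (*-comm _ _) N)) ⟩
    p * ((1# + r ^ suc m) * W r (r ^ suc m) N)
      ≈⟨ solve 3 (λ p a w → p :* (a :* w) := a :* p :* w) refl _ _ _ ⟩
    qPochhammer r (suc m) * W r (r ^ suc m) N        ∎
    where p = qPochhammer r m

  -- The two copies of the product have different origins. One is collected from N + 1 uses of the
  -- functional equation, which move the argument from 1 to r^(N+1) = 0; the other is the value of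
  -- `W` at 0, where only the summand j = 0 survives.
  W-1 : ∀ r N → r ^ suc N ≈ 0# → W r 1# N ≈ qPochhammer r N * qPochhammer r N
  W-1 r N r^≈0 = begin
    W r 1# N ≈⟨ W-iterate r N r^≈0 (suc N) ⟩
    (1# + r ^ suc N) * qPochhammer r N * W r (r ^ suc N) N
      ≈⟨ *-cong (*-congʳ (+-congˡ r^≈0)) (trans (W-cong r r^≈0 N) (W-0 r N)) ⟩
    (1# + 0#) * qPochhammer r N * qPochhammer r N
      ≈⟨ *-congʳ (trans (*-congʳ (+-identityʳ 1#)) (*-identityˡ _)) ⟩
    qPochhammer r N * qPochhammer r N ∎

  Σ< : (ℕ → Carrier) → ℕ → Carrier
  Σ< f zero    = 0#
  Σ< f (suc k) = f k + Σ< f k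

  Σ<-cong : ∀ {f g} k → (∀ i → i ℕ.< k → f i ≈ g i) → Σ< f k ≈ Σ< g k
  Σ<-cong zero    f≈g = refl
  Σ<-cong (suc k) f≈g = +-cong (f≈g k ℕ.≤-refl) (Σ<-cong k (λ i i<k → f≈g i (ℕ.m<n⇒m<1+n i<k)))

  Σ<-distribˡ : ∀ a f k → Σ< (λ i → a * f i) k ≈ a * Σ< f k
  Σ<-distribˡ a f zero    = sym (zeroʳ a)
  Σ<-distribˡ a f (suc k) = trans (+-congˡ (Σ<-distribˡ a f k)) (sym (distribˡ a _ _))

  -- The factor of ∏_{j<i≤k} (1 + rⁱ) at i = l + 1, padded with ones for i ≤ j so that the products
  -- for all j have the same length.
  tail : Carrier → ℕ → ℕ → Carrier
  tail r j l = if does (j ℕ.<? suc l) then 1# + r ^ suc l else 1#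

  tail-≤ : ∀ r {j l} → j ℕ.≤ l → tail r j l ≡ 1# + r ^ suc l
  tail-≤ r {j} {l} j≤l = cong (if_then 1# + r ^ suc l else 1#) (dec-true (j ℕ.<? suc l) (ℕ.s≤s j≤l))

  ∏-tail≈1 : ∀ r j k → k ℕ.≤ j → ∏ (tail r j) k ≈ 1#
  ∏-tail≈1 r j zero    _     = refl
  ∏-tail≈1 r j (suc k) 1+k≤j = begin
    tail r j k * ∏ (tail r j) k
      ≈⟨ *-cong (reflexive (cong (if_then 1# + r ^ suc k else 1#)
           (dec-false (j ℕ.<? suc k) (ℕ.≤⇒≯ 1+k≤j)))) (∏-tail≈1 r j k (ℕ.<⇒≤ 1+k≤j)) ⟩
    1# * 1# ≈⟨ *-identityˡ 1# ⟩
    1#      ∎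

  -- Raising `k` multiplies each old summand by 1 + r^(k+1) and adds the summand j = k + 1, whose
  -- tail is empty. This is the recursion of `W` at y = 1.
  Σ<-tail : ∀ r k → Σ< (λ j → r ^ tri j * ∏ (tail r j) k) (suc k) ≈ W r 1# k
  Σ<-tail r zero    = solve 0 (:1 :* :1 :+ con false := :1) refl
  Σ<-tail r (suc k) = begin
    r ^ tri (suc k) * ∏ (tail r (suc k)) (suc k) + Σ< (λ j → r ^ tri j * ∏ (tail r j) (suc k)) (suc k)
      ≈⟨ +-cong (*-congˡ (∏-tail≈1 r (suc k) (suc k) ℕ.≤-refl))
           (Σ<-cong (suc k) (λ j j<1+k → trans
             (*-congˡ (*-congʳ (reflexive (tail-≤ r (ℕ.s≤s⁻¹ j<1+k)))))
             (solve 3 (λ a b c → a :* (b :* c) := b :* (a :* c)) refl _ _ _))) ⟩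
    r ^ tri (suc k) * 1# + Σ< (λ j → (1# + r ^ suc k) * (r ^ tri j * ∏ (tail r j) k)) (suc k)
      ≈⟨ +-cong (*-comm _ _) (trans (Σ<-distribˡ _ _ (suc k)) (*-congˡ (Σ<-tail r k))) ⟩
    1# * r ^ tri (suc k) + (1# + r ^ suc k) * W r 1# k
      ≈⟨ +-comm _ _ ⟩
    (1# + r ^ suc k) * W r 1# k + 1# * r ^ tri (suc k)
      ≈⟨ +-congˡ (*-congʳ (sym (1^n≈1 (suc k)))) ⟩
    W r 1# (suc k) ∎

  -- Gauss's identity and the product for the partitions

  module _ (q : Carrier) where

    r : Carrier
    r = q * q

    q^[n*2]≈r^n : ∀ n → q ^ (n ℕ.* 2) ≈ r ^ n
    q^[n*2]≈r^n zero    = refl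
    q^[n*2]≈r^n (suc n) = trans (sym (*-assoc q q _)) (*-congˡ (q^[n*2]≈r^n n))

    O E : ℕ → Carrier
    O = ∏ (λ i → 1# + q ^ suc (i ℕ.* 2))
    E = qPochhammer r

    θ : ℕ → Carrier
    θ = Σ< (λ k → q ^ tri k)

    -- V x k = Σ_{s≤k} O s xˢ ∏_{s<i≤k} (1 + q²ⁱ), from Shanks' proof of Gauss's identity.
    V : Carrier → ℕ → Carrier
    V x zero    = 1#
    V x (suc k) = (1# + r ^ suc k) * V x k + O (suc k) * x ^ suc k

    V-cong : ∀ {x y} → x ≈ y → ∀ k → V x k ≈ V y k
    V-cong x≈y zero    = refl
    V-cong x≈y (suc k) = +-cong (*-congˡ (V-cong x≈y k)) (*-congˡ (^-congˡ (suc k) x≈y))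

    V-0 : ∀ k → V 0# k ≈ E k
    V-0 zero    = refl
    V-0 (suc k) = begin
      (1# + r ^ suc k) * V 0# k + O (suc k) * (0# * 0# ^ k)
        ≈⟨ +-cong (*-congˡ (V-0 k)) (trans (*-congˡ (zeroˡ _)) (zeroʳ _)) ⟩
      (1# + r ^ suc k) * E k + 0# ≈⟨ +-identityʳ _ ⟩
      (1# + r ^ suc k) * E k      ∎

    -- In the induction the coefficients of `o * b` add up to x (1 + q r^(k+1)), and 1 + q^(2k+3) is
    -- exactly the next factor of `O`. So the defect is again one term, of the same shape.
    V-shift : ∀ x k → (1# + x) * V x k + (1# + x * q) * V (x * r) k ≈ O (suc k) * x ^ suc k
    V-shift x zero = solve 2 (λ x q →
      (:1 :+ x) :* :1 :+ (:1 :+ x :* q) :* :1 := (:1 :+ q :* :1) :* :1 :* (x :* :1)) refl x q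
    V-shift x (suc k) = begin
      (1# + x) * ((1# + a) * v + o * b) + (1# + x * q) * ((1# + a) * v′ + o * (x * r) ^ suc k)
        ≈⟨ +-congˡ (*-congˡ (+-congˡ (*-congˡ (^-distrib-* x r (suc k))))) ⟩
      (1# + x) * ((1# + a) * v + o * b) + (1# + x * q) * ((1# + a) * v′ + o * (b * a))
        ≈⟨ solve 7 (λ x q a o b v v′ →
             (:1 :+ x) :* ((:1 :+ a) :* v :+ o :* b) :+ (:1 :+ x :* q) :* ((:1 :+ a) :* v′ :+ o :* (b :* a))
             := (:1 :+ a) :* ((:1 :+ x) :* v :+ (:1 :+ x :* q) :* v′)
                :+ (:1 :+ x :+ (:1 :+ x :* q) :* a) :* (o :* b)) refl x q a o b v v′ ⟩
      (1# + a) * ((1# + x) * v + (1# + x * q) * v′) + (1# + x + (1# + x * q) * a) * (o * b)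
        ≈⟨ +-congʳ (*-congˡ (V-shift x k)) ⟩
      (1# + a) * (o * b) + (1# + x + (1# + x * q) * a) * (o * b)
        ≈⟨ solve 5 (λ x q a o b →
             (:1 :+ a) :* (o :* b) :+ (:1 :+ x :+ (:1 :+ x :* q) :* a) :* (o :* b)
             := (:1 :+ q :* a) :* o :* (x :* b)) refl x q a o b ⟩
      (1# + q * a) * o * (x * b)
        ≈⟨ *-congʳ (*-congʳ (+-congˡ (*-congˡ (sym (q^[n*2]≈r^n (suc k)))))) ⟩
      O (suc (suc k)) * x ^ suc (suc k) ∎
      where
      a = r ^ suc k
      b = x ^ suc k
      o = O (suc k)
      v = V x k
      v′ = V (x * r) k

    -- Passing from n to n + 1 adds two triangular powers, x^(n+1) and z^(n+1) with x = q^(2n+1) and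
    -- z = q^(2n+3). The first, times `O (suc n)`, is the defect in `V-shift` and moves the argument
    -- of `V` from x to x r = z. The second, times the same factor, is the new last term of
    -- `V z (suc n)`.
    shanks : ∀ n → O n * θ (suc (n ℕ.* 2)) ≈ V (q ^ suc (n ℕ.* 2)) n
    shanks zero    = solve 0 (:1 :* (:1 :+ con false) := :1) refl
    shanks (suc n) = begin
      (1# + x) * O n * (q ^ tri (suc n ℕ.* 2) + (q ^ tri (suc (n ℕ.* 2)) + θ (suc (n ℕ.* 2))))
        ≈⟨ solve 5 (λ x o s t u →
             (:1 :+ x) :* o :* (s :+ (t :+ u)) := (:1 :+ x) :* (o :* u) :+ (:1 :+ x) :* o :* (t :+ s))
             refl _ _ _ _ _ ⟩
      (1# + x) * (O n * θ (suc (n ℕ.* 2))) + O (suc n) * (q ^ tri (suc (n ℕ.* 2)) + q ^ tri (suc n ℕ.* 2))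
        ≈⟨ +-cong (*-congˡ (shanks n)) (*-congˡ (+-cong
             (trans (reflexive (cong (q ^_) (tri-odd n))) (sym (^-assocʳ q (suc (n ℕ.* 2)) (suc n))))
             (trans (reflexive (cong (q ^_) (tri-even (suc n)))) (sym (^-assocʳ q (suc (suc n ℕ.* 2)) (suc n)))))) ⟩
      (1# + x) * V x n + O (suc n) * (x ^ suc n + z ^ suc n)
        ≈⟨ solve 4 (λ v o s t → v :+ o :* (s :+ t) := v :+ o :* s :+ o :* t) refl _ _ _ _ ⟩
      (1# + x) * V x n + O (suc n) * x ^ suc n + O (suc n) * z ^ suc n
        ≈⟨ +-congʳ (+-congˡ (sym (V-shift x n))) ⟩
      (1# + x) * V x n + ((1# + x) * V x n + (1# + x * q) * V (x * r) n) + O (suc n) * z ^ suc n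
        ≈⟨ +-congʳ (solve 2 (λ u v → u :+ (u :+ v) := v) refl _ _) ⟩
      (1# + x * q) * V (x * r) n + O (suc n) * z ^ suc n
        -- Since x q = r^(n+1), the factor 1 + x q is the one in the recursion of `V`.
        ≈⟨ +-congʳ (*-cong (+-congˡ xq≈) (V-cong xr≈z n)) ⟩
      V z (suc n) ∎
      where
      x = q ^ suc (n ℕ.* 2)
      z = q ^ suc (suc n ℕ.* 2)
      xq≈ : x * q ≈ r ^ suc n
      xq≈ = trans (*-comm x q) (q^[n*2]≈r^n (suc n))
      xr≈z : x * r ≈ z
      xr≈z = solve 2 (λ x q → x :* (q :* q) := q :* (q :* x)) refl x q

    module _ (N : ℕ) (q^≈0 : q ^ suc N ≈ 0#) where

      r^≈0 : ∀ i → N ℕ.≤ i → r ^ suc i ≈ 0#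
      r^≈0 i N≤i = trans (sym (q^[n*2]≈r^n (suc i)))
        (^-vanishes q^≈0 (ℕ.≤-trans (ℕ.s≤s N≤i) (ℕ.m≤m*n (suc i) 2)))

      -- At n = N the argument q^(2N+1) of `V` is zero, which leaves only the term s = 0.
      O-θ : O N * θ (suc (N ℕ.* 2)) ≈ E N
      O-θ = trans (shanks N) (trans
        (V-cong (^-vanishes q^≈0 (ℕ.s≤s (ℕ.m≤m*n N 2))) N) (V-0 N))

      O-invertible : Invertible (O N)
      O-invertible = ∏-invertible _ (λ i → 1+nilpotent-invertible _ N (begin
        (q ^ suc (i ℕ.* 2)) ^ suc N   ≈⟨ ^-assocʳ q (suc (i ℕ.* 2)) (suc N) ⟩
        q ^ (suc (i ℕ.* 2) ℕ.* suc N) ≈⟨ ^-vanishes q^≈0 (ℕ.m≤n*m (suc N) (suc (i ℕ.* 2))) ⟩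
        0#                            ∎)) N

      -- Frobenius squares ∏_{i≤2N} (1 + qⁱ) = O E factor by factor, giving E again.
      OE² : (O N * E N) * (O N * E N) ≈ E N
      OE² = begin
        (O N * E N) * (O N * E N) ≈⟨ *-cong OE OE ⟨
        qPochhammer q (N ℕ.* 2) * qPochhammer q (N ℕ.* 2) ≈⟨ ∏-* _ _ (N ℕ.* 2) ⟨
        ∏ (λ i → (1# + q ^ suc i) * (1# + q ^ suc i)) (N ℕ.* 2)
          ≈⟨ ∏-cong (λ i → trans
               (solve 1 (λ x → (:1 :+ x) :* (:1 :+ x) := :1 :+ x :* x) refl _)
               (+-congˡ (sym (^-distrib-* q q (suc i))))) (N ℕ.* 2) ⟩
        E (N ℕ.* 2)     ≡⟨ cong E (double N) ⟩
        E (N ℕ.+ N)     ≈⟨ ∏-stable _ N (λ i N≤i → trans (+-congˡ (r^≈0 i N≤i)) (+-identityʳ 1#)) N ⟩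
        E N             ∎
        where
        OE : qPochhammer q (N ℕ.* 2) ≈ O N * E N
        OE = trans (∏-pair _ N) (*-congˡ (∏-cong (λ i → +-congˡ (q^[n*2]≈r^n (suc i))) N))

      O*W≈θ : O N * W r 1# N ≈ θ (suc (N ℕ.* 2))
      O*W≈θ = *-cancelˡ-invertible O-invertible (begin
        O N * (O N * W r 1# N)      ≈⟨ *-congˡ (*-congˡ (W-1 r N (r^≈0 N ℕ.≤-refl))) ⟩
        O N * (O N * (E N * E N))
          ≈⟨ solve 2 (λ o e → o :* (o :* (e :* e)) := (o :* e) :* (o :* e)) refl _ _ ⟩
        (O N * E N) * (O N * E N)   ≈⟨ OE² ⟩
        E N                         ≈⟨ O-θ ⟨
        O N * θ (suc (N ℕ.* 2))     ∎)

    -- The factor of the part i + 1 in the Euler product for partitions whose multiplicities are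
    -- taken from the lists `A`.
    weight : (ℕ → List ℕ) → ℕ → Carrier
    weight A i = foldr (λ m x → q ^ (m ℕ.* suc i) + x) 0# (A (suc i))

    -- The forced copies of the part i + 1, and the choice of one further copy.
    stair free-factor : ℕ → ℕ → Carrier
    stair j i = q ^ (base j (suc i) ℕ.* suc i)
    free-factor j i = if free j (suc i) then 1# + q ^ suc i else 1#

    weight-allowed : ∀ j i → weight (allowed j) i ≈ stair j i * free-factor j i
    weight-allowed j i with free j (suc i)
    ... | true  = begin
      q ^ (b ℕ.* suc i) + (q ^ (suc i ℕ.+ b ℕ.* suc i) + 0#)
        ≈⟨ +-congˡ (+-congʳ (^-homo-* q (suc i) (b ℕ.* suc i))) ⟩
      q ^ (b ℕ.* suc i) + (q ^ suc i * q ^ (b ℕ.* suc i) + 0#)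
        ≈⟨ solve 2 (λ x y → x :+ (y :* x :+ con false) := x :* (:1 :+ y)) refl _ _ ⟩
      q ^ (b ℕ.* suc i) * (1# + q ^ suc i) ∎
      where b = base j (suc i)
    ... | false = trans (+-identityʳ _) (sym (*-identityʳ _))

    -- Two forced copies of each of 1, ..., k weigh 2 (1 + ⋯ + k) together, and r = q².
    ∏-stair-≤ : ∀ j k → k ℕ.≤ j → ∏ (stair j) k ≈ r ^ tri k
    ∏-stair-≤ j zero    _     = refl
    ∏-stair-≤ j (suc k) 1+k≤j = begin
      q ^ (base j (suc k) ℕ.* suc k) * ∏ (stair j) k
        ≈⟨ *-cong (reflexive (cong (q ^_) (≡.trans (cong (ℕ._* suc k) (base-≤ 1+k≤j)) (ℕ.*-comm 2 (suc k)))))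
             (∏-stair-≤ j k (ℕ.<⇒≤ 1+k≤j)) ⟩
      q ^ (suc k ℕ.* 2) * r ^ tri k ≈⟨ *-congʳ (q^[n*2]≈r^n (suc k)) ⟩
      r ^ suc k * r ^ tri k         ≈⟨ ^-homo-* r (suc k) (tri k) ⟨
      r ^ tri (suc k)               ∎

    ∏-stair : ∀ j k → j ℕ.≤ k → ∏ (stair j) k ≈ r ^ tri j
    ∏-stair j k j≤k = begin
      ∏ (stair j) k               ≡⟨ cong (∏ (stair j)) (ℕ.m∸n+n≡m j≤k) ⟨
      ∏ (stair j) (k ℕ.∸ j ℕ.+ j)
        ≈⟨ ∏-stable (stair j) j (λ i j≤i → reflexive
             (cong (λ b → q ^ (b ℕ.* suc i)) (base-> (ℕ.s≤s j≤i)))) (k ℕ.∸ j) ⟩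
      ∏ (stair j) j               ≈⟨ ∏-stair-≤ j j ℕ.≤-refl ⟩
      r ^ tri j                   ∎

    -- Odd parts are free for every j. The even part 2i is free exactly when i > j, because case (b)
    -- resumes even parts only beyond 2j, and q²ⁱ = rⁱ turns these factors into `tail`.
    ∏-free-factor : ∀ j k → ∏ (free-factor j) (k ℕ.* 2) ≈ O k * ∏ (tail r j) k
    ∏-free-factor j k = trans (∏-pair (free-factor j) k) (*-cong
      (∏-cong (λ l → reflexive (cong (if_then 1# + q ^ suc (l ℕ.* 2) else 1#)
        (free-odd j (suc (l ℕ.* 2)) (odd-1+2* l)))) k)
      (∏-cong (λ l → trans
        (reflexive (cong (if_then 1# + q ^ (suc l ℕ.* 2) else 1#) (free-double j (suc l))))
        (if-cong (does (j ℕ.<? suc l)) (+-congˡ (q^[n*2]≈r^n (suc l))))) k))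
      where
      if-cong : ∀ b {x y} → x ≈ y → (if b then x else 1#) ≈ (if b then y else 1#)
      if-cong true  x≈y = x≈y
      if-cong false x≈y = refl

    ∏-weight-allowed : ∀ k j → j ℕ.≤ k →
                       ∏ (weight (allowed j)) (k ℕ.* 2) ≈ O k * (r ^ tri j * ∏ (tail r j) k)
    ∏-weight-allowed k j j≤k = begin
      ∏ (weight (allowed j)) (k ℕ.* 2)
        ≈⟨ trans (∏-cong (weight-allowed j) (k ℕ.* 2)) (∏-* (stair j) (free-factor j) (k ℕ.* 2)) ⟩
      ∏ (stair j) (k ℕ.* 2) * ∏ (free-factor j) (k ℕ.* 2)
        ≈⟨ *-cong (∏-stair j (k ℕ.* 2) (ℕ.≤-trans j≤k (ℕ.m≤m*n k 2))) (∏-free-factor j k) ⟩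
      r ^ tri j * (O k * ∏ (tail r j) k)
        ≈⟨ solve 3 (λ a b c → a :* (b :* c) := b :* (a :* c)) refl _ _ _ ⟩
      O k * (r ^ tri j * ∏ (tail r j) k) ∎

    Σ<-weight-allowed≈θ : ∀ N → q ^ suc N ≈ 0# →
                          Σ< (λ j → ∏ (weight (allowed j)) (N ℕ.* 2)) (suc N) ≈ θ (suc (N ℕ.* 2))
    Σ<-weight-allowed≈θ N q^≈0 = begin
      Σ< (λ j → ∏ (weight (allowed j)) (N ℕ.* 2)) (suc N)
        ≈⟨ Σ<-cong (suc N) (λ j j<1+N → ∏-weight-allowed N j (ℕ.s≤s⁻¹ j<1+N)) ⟩
      Σ< (λ j → O N * (r ^ tri j * ∏ (tail r j) N)) (suc N) ≈⟨ Σ<-distribˡ (O N) _ (suc N) ⟩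
      O N * Σ< (λ j → r ^ tri j * ∏ (tail r j) N) (suc N)   ≈⟨ *-congˡ (Σ<-tail r N) ⟩
      O N * W r 1# N                                        ≈⟨ O*W≈θ N q^≈0 ⟩
      θ (suc (N ℕ.* 2))                                     ∎

-- Power series over F₂

open ≡ using (refl; sym; trans)

Series : Set
Series = ℕ → Bool

infixl 6 _⊕_
infixl 7 _⊛_ _·_

_⊕_ : Series → Series → Series
(f ⊕ g) n = f n xor g n

_·_ : Bool → Series → Series
(a · f) n = a ∧ f n

-- The Cauchy product by structural recursion on the degree, through f = f(0) + q f′ with f′ =
-- `f ∘ suc`.
_⊛_ : Series → Series → Series
(f ⊛ g) zero    = f 0 ∧ g 0
(f ⊛ g) (suc n) = (f 0 ∧ g (suc n)) xor ((f ∘ suc) ⊛ g) n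

𝟘 𝟙 𝕢 : Series
𝟘 _       = false
𝟙 zero    = true
𝟙 (suc _) = false
𝕢 zero    = false
𝕢 (suc n) = 𝟙 n

-- Coefficient n of a product sees only coefficients up to n of the factors, so equality up to a
-- fixed degree is a congruence.
⊛-cong : ∀ {f f′ g g′} n → (∀ m → m ℕ.≤ n → f m ≡ f′ m) → (∀ m → m ℕ.≤ n → g m ≡ g′ m) →
         (f ⊛ g) n ≡ (f′ ⊛ g′) n
⊛-cong zero    f≡ g≡ = cong₂ _∧_ (f≡ 0 ℕ.z≤n) (g≡ 0 ℕ.z≤n)
⊛-cong (suc n) f≡ g≡ = cong₂ _xor_ (cong₂ _∧_ (f≡ 0 ℕ.z≤n) (g≡ (suc n) ℕ.≤-refl))
  (⊛-cong n (λ m m≤n → f≡ (suc m) (ℕ.s≤s m≤n)) (λ m m≤n → g≡ m (ℕ.m≤n⇒m≤1+n m≤n)))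

xor-medial : ∀ a b c d → (a xor b) xor (c xor d) ≡ (a xor c) xor (b xor d)
xor-medial false b c d = trans (sym (xor-assoc b c d)) (trans (cong (_xor d) (xor-comm b c)) (xor-assoc c b d))
xor-medial true  b c d = trans (sym (not-distribˡ-xor b (c xor d)))
  (trans (cong not (xor-medial false b c d)) (not-distribˡ-xor c (b xor d)))

⊛-distribˡ : ∀ f g h n → (f ⊛ (g ⊕ h)) n ≡ ((f ⊛ g) ⊕ (f ⊛ h)) n
⊛-distribˡ f g h zero    = ∧-distribˡ-xor (f 0) (g 0) (h 0)
⊛-distribˡ f g h (suc n) = trans
  (cong₂ _xor_ (∧-distribˡ-xor (f 0) (g (suc n)) (h (suc n))) (⊛-distribˡ (f ∘ suc) g h n))
  (xor-medial (f 0 ∧ g (suc n)) _ _ _)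

⊛-distribʳ : ∀ h f g n → ((f ⊕ g) ⊛ h) n ≡ ((f ⊛ h) ⊕ (g ⊛ h)) n
⊛-distribʳ h f g zero    = ∧-distribʳ-xor (h 0) (f 0) (g 0)
⊛-distribʳ h f g (suc n) = trans
  (cong₂ _xor_ (∧-distribʳ-xor (h (suc n)) (f 0) (g 0)) (⊛-distribʳ h (f ∘ suc) (g ∘ suc) n))
  (xor-medial (f 0 ∧ h (suc n)) _ _ _)

⊛-zeroˡ : ∀ f n → (𝟘 ⊛ f) n ≡ false
⊛-zeroˡ f zero    = refl
⊛-zeroˡ f (suc n) = ⊛-zeroˡ f n

⊛-identityˡ : ∀ f n → (𝟙 ⊛ f) n ≡ f n
⊛-identityˡ f zero    = refl
⊛-identityˡ f (suc n) = trans (cong (f (suc n) xor_) (⊛-zeroˡ f n)) (xor-identityʳ (f (suc n)))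

-- The mirror image of the defining recursion, which peels the constant term off the right factor;
-- commutativity then takes one induction.
⊛-sucʳ : ∀ f g n → (f ⊛ g) (suc n) ≡ (f (suc n) ∧ g 0) xor (f ⊛ (g ∘ suc)) n
⊛-sucʳ f g zero    = xor-comm (f 0 ∧ g 1) (f 1 ∧ g 0)
⊛-sucʳ f g (suc n) = begin
  a xor ((f ∘ suc) ⊛ g) (suc n) ≡⟨ cong (a xor_) (⊛-sucʳ (f ∘ suc) g n) ⟩
  a xor (b xor c)               ≡⟨ xor-medial false a b c ⟩
  b xor (a xor c)               ∎
  where
  open ≡-Reasoning
  a = f 0 ∧ g (suc (suc n))
  b = f (suc (suc n)) ∧ g 0
  c = ((f ∘ suc) ⊛ (g ∘ suc)) n

⊛-comm : ∀ f g n → (f ⊛ g) n ≡ (g ⊛ f) n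
⊛-comm f g zero    = ∧-comm (f 0) (g 0)
⊛-comm f g (suc n) = trans
  (cong₂ _xor_ (∧-comm (f 0) (g (suc n))) (⊛-comm (f ∘ suc) g n))
  (sym (⊛-sucʳ g f n))

·-⊛ : ∀ a f g n → ((a · f) ⊛ g) n ≡ a ∧ (f ⊛ g) n
·-⊛ true  f g n = ⊛-cong n (λ _ _ → refl) (λ _ _ → refl)
·-⊛ false f g n = ⊛-zeroˡ g n

⊛-assoc : ∀ f g h n → ((f ⊛ g) ⊛ h) n ≡ (f ⊛ (g ⊛ h)) n
⊛-assoc f g h zero    = ∧-assoc (f 0) (g 0) (h 0)
⊛-assoc f g h (suc n) = begin
  -- The series (f ⊛ g) ∘ suc unfolds to the sum that stands here as left factor.
  ((f 0 ∧ g 0) ∧ h (suc n)) xor ((((f 0 · (g ∘ suc)) ⊕ ((f ∘ suc) ⊛ g)) ⊛ h) n)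
    ≡⟨ cong₂ _xor_ (∧-assoc (f 0) (g 0) _) (⊛-distribʳ h (f 0 · (g ∘ suc)) ((f ∘ suc) ⊛ g) n) ⟩
  (f 0 ∧ (g 0 ∧ h (suc n))) xor (((f 0 · (g ∘ suc)) ⊛ h) n xor (((f ∘ suc) ⊛ g) ⊛ h) n)
    ≡⟨ cong ((f 0 ∧ (g 0 ∧ h (suc n))) xor_)
         (cong₂ _xor_ (·-⊛ (f 0) (g ∘ suc) h n) (⊛-assoc (f ∘ suc) g h n)) ⟩
  (f 0 ∧ (g 0 ∧ h (suc n))) xor ((f 0 ∧ ((g ∘ suc) ⊛ h) n) xor ((f ∘ suc) ⊛ (g ⊛ h)) n)
    ≡⟨ xor-assoc (f 0 ∧ (g 0 ∧ h (suc n))) _ _ ⟨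
  ((f 0 ∧ (g 0 ∧ h (suc n))) xor (f 0 ∧ ((g ∘ suc) ⊛ h) n)) xor ((f ∘ suc) ⊛ (g ⊛ h)) n
    ≡⟨ cong (_xor ((f ∘ suc) ⊛ (g ⊛ h)) n) (∧-distribˡ-xor (f 0) _ _) ⟨
  (f ⊛ (g ⊛ h)) (suc n) ∎
  where open ≡-Reasoning

-- F₂[[q]] / (q^{N+1}), with truncation expressed by the setoid equality.
truncatedSeries : ℕ → CommutativeRing _ _
truncatedSeries N = record
  { Carrier = Series
  ; _≈_ = λ f g → ∀ n → n ℕ.≤ N → f n ≡ g n
  ; _+_ = _⊕_
  ; _*_ = _⊛_
  ; -_ = id
  ; 0# = 𝟘
  ; 1# = 𝟙
  ; isCommutativeRing = record
    { isRing = record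
      { +-isAbelianGroup = record
        { isGroup = record
          { isMonoid = record
            { isSemigroup = record
              { isMagma = record
                { isEquivalence = record
                  { refl = λ _ _ → refl
                  ; sym = λ f≈g n n≤N → sym (f≈g n n≤N)
                  ; trans = λ f≈g g≈h n n≤N → trans (f≈g n n≤N) (g≈h n n≤N)
                  }
                ; ∙-cong = λ f≈ g≈ n n≤N → cong₂ _xor_ (f≈ n n≤N) (g≈ n n≤N)
                }
              ; assoc = λ f g h n _ → xor-assoc (f n) (g n) (h n)
              }
            ; identity = (λ _ _ _ → refl) , (λ f n _ → xor-identityʳ (f n))
            }
          ; inverse = (λ f n _ → xor-same (f n)) , (λ f n _ → xor-same (f n))
          ; ⁻¹-cong = id
          }
        ; comm = λ f g n _ → xor-comm (f n) (g n)
        }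
      ; *-cong = λ f≈ g≈ n n≤N → ⊛-cong n
          (λ m m≤n → f≈ m (ℕ.≤-trans m≤n n≤N)) (λ m m≤n → g≈ m (ℕ.≤-trans m≤n n≤N))
      ; *-assoc = λ f g h n _ → ⊛-assoc f g h n
      ; *-identity = (λ f n _ → ⊛-identityˡ f n)
                   , (λ f n _ → trans (⊛-comm f 𝟙 n) (⊛-identityˡ f n))
      ; distrib = (λ f g h n _ → ⊛-distribˡ f g h n) , (λ f g h n _ → ⊛-distribʳ f g h n)
      }
    ; *-comm = λ f g n _ → ⊛-comm f g n
    }
  }

-- Parity and extraction of coefficients

odd : ℕ → Bool
odd zero    = false
odd (suc n) = not (odd n)

odd-+ : ∀ m n → odd (m ℕ.+ n) ≡ odd m xor odd n
odd-+ zero    n = refl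
odd-+ (suc m) n = trans (cong not (odd-+ m n)) (not-distribˡ-xor (odd m) (odd n))

odd-%2 : ∀ n → n ℕ.% 2 ≡ (if odd n then 1 else 0)
odd-%2 zero          = refl
odd-%2 (suc zero)    = refl
odd-%2 (suc (suc n)) = trans (odd-%2 n) (cong (λ b → if b then 1 else 0) (sym (not-involutive (odd n))))

-- Multiplication by q^e, that is n ↦ f (n - e) with default `z` for n < e. It is polymorphic so
-- that `shift-natural` can compare the shift of lists of partitions (default `[]`) with that of
-- their parities (default `false`).
shift : ∀ {a} {A : Set a} → A → ℕ → (ℕ → A) → ℕ → A
shift z zero    f n       = f n
shift z (suc e) f zero    = z
shift z (suc e) f (suc n) = shift z e f n

module Coefficients (N : ℕ) where
  1+1≈0-truncated : 1+1≈0 (truncatedSeries N)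
  1+1≈0-truncated n _ = xor-same (𝟙 n)

  open CharacteristicTwo (truncatedSeries N) 1+1≈0-truncated public
  open CommutativeRing (truncatedSeries N) using (semiring)
  open Algebra.Properties.Semiring.Exp semiring public using (_^_)

  𝕢⊛ : ∀ f n → (𝕢 ⊛ f) n ≡ shift false 1 f n
  𝕢⊛ f zero    = refl
  𝕢⊛ f (suc n) = ⊛-identityˡ f n

  𝕢^⊛ : ∀ e f n → ((𝕢 ^ e) ⊛ f) n ≡ shift false e f n
  𝕢^⊛ zero    f n = ⊛-identityˡ f n
  𝕢^⊛ (suc e) f n = trans (⊛-assoc 𝕢 (𝕢 ^ e) f n) (trans (𝕢⊛ ((𝕢 ^ e) ⊛ f) n) (helper n))
    where
    helper : ∀ n → shift false 1 ((𝕢 ^ e) ⊛ f) n ≡ shift false (suc e) f n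
    helper zero    = refl
    helper (suc n) = 𝕢^⊛ e f n

  𝕢^-coefficient : ∀ e n → (𝕢 ^ e) n ≡ (e ℕ.≡ᵇ n)
  𝕢^-coefficient zero    zero    = refl
  𝕢^-coefficient zero    (suc n) = refl
  𝕢^-coefficient (suc e) zero    = 𝕢⊛ (𝕢 ^ e) 0
  𝕢^-coefficient (suc e) (suc n) = trans (𝕢⊛ (𝕢 ^ e) (suc n)) (𝕢^-coefficient e n)

  𝕢^-diagonal : ∀ e → (𝕢 ^ e) e ≡ true
  𝕢^-diagonal e = trans (𝕢^-coefficient e e) (Equivalence.to T-≡ (ℕ.≡⇒≡ᵇ e e refl))

  𝕢^-off-diagonal : ∀ {e n} → e ≢ n → (𝕢 ^ e) n ≡ false
  𝕢^-off-diagonal {e} {n} e≢n = trans (𝕢^-coefficient e n) (¬-not (λ eq → e≢n (ℕ.≡ᵇ⇒≡ e n (Equivalence.from T-≡ eq))))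

  𝕢^suc[N]≈0 : ∀ n → n ℕ.≤ N → (𝕢 ^ suc N) n ≡ false
  𝕢^suc[N]≈0 n n≤N = 𝕢^-off-diagonal (λ eq → ℕ.<-irrefl (sym eq) (ℕ.s≤s n≤N))

  Σ<-off-support : ∀ (e : ℕ → ℕ) K n → (∀ k → k ℕ.< K → e k ≢ n) → Σ< (λ k → 𝕢 ^ e k) K n ≡ false
  Σ<-off-support e zero    n e≢n = refl
  Σ<-off-support e (suc K) n e≢n = cong₂ _xor_ (𝕢^-off-diagonal (e≢n K ℕ.≤-refl))
    (Σ<-off-support e K n (λ k k<K → e≢n k (ℕ.m<n⇒m<1+n k<K)))

  -- Strict monotonicity makes the exponents distinct, so exactly one summand contributes and
  -- nothing cancels modulo 2.
  Σ<-on-support : ∀ (e : ℕ → ℕ) → (∀ {i j} → i ℕ.< j → e i ℕ.< e j) → ∀ K k → k ℕ.< K →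
                  Σ< (λ k → 𝕢 ^ e k) K (e k) ≡ true
  Σ<-on-support e mono (suc K) k k<1+K with k ℕ.≟ K
  ... | yes refl = cong₂ _xor_ (𝕢^-diagonal (e k))
        (Σ<-off-support e K (e k) (λ i i<k → ℕ.<⇒≢ (mono i<k)))
  ... | no k≢K = cong₂ _xor_ (𝕢^-off-diagonal (λ eq → ℕ.<⇒≢ (mono k<K) (sym eq)))
        (Σ<-on-support e mono K k k<K)
    where
    k<K : k ℕ.< K
    k<K = ℕ.≤∧≢⇒< (ℕ.s≤s⁻¹ k<1+K) k≢K

-- Enumerating partitions by multiplicities

mult-++ : ∀ i xs ys → mult i (xs ++ ys) ≡ mult i xs ℕ.+ mult i ys
mult-++ i xs ys = trans (cong length (filter-++ (i ℕ.≟_) xs ys)) (length-++ (filter (i ℕ.≟_) xs))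

mult-replicate-≡ : ∀ m i → mult i (replicate m i) ≡ m
mult-replicate-≡ m i = trans
  (cong length (filter-all (i ℕ.≟_) (All.replicate⁺ m refl))) (length-replicate m)

mult-replicate-≢ : ∀ m {i x} → i ≢ x → mult i (replicate m x) ≡ 0
mult-replicate-≢ m {i} i≢x = cong length (filter-none (i ℕ.≟_) (All.replicate⁺ m i≢x))

mult-above : ∀ {k i ps} → All (_≤ k) ps → k < i → mult i ps ≡ 0
mult-above {i = i} ps≤k k<i = cong length
  (filter-none (i ℕ.≟_) (All.map (λ p≤k i≡p → ℕ.<-irrefl (sym i≡p) (ℕ.≤-<-trans p≤k k<i)) ps≤k))

sum-replicate : ∀ m x → sum (replicate m x) ≡ m ℕ.* x
sum-replicate zero    x = refl
sum-replicate (suc m) x = cong (x ℕ.+_) (sum-replicate m x)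

linked-replicate-++ : ∀ {k} m {ps} → All (_≤ k) ps → Linked ℕ._≥_ ps →
                      Linked ℕ._≥_ (replicate m k ++ ps)
linked-replicate-++ zero          ps≤k       ps↘ = ps↘
linked-replicate-++ (suc zero)    []         ps↘ = [-]
linked-replicate-++ (suc zero)    (p≤k ∷ _)  ps↘ = p≤k ∷ ps↘
linked-replicate-++ (suc (suc m)) ps≤k       ps↘ = ℕ.≤-refl ∷ linked-replicate-++ (suc m) ps≤k ps↘

-- The first entry below k + 1 bounds everything after it, so the copies of k + 1 form a prefix.
-- This inverts the prepending done by `build`.
split-largest : ∀ k ps → Linked ℕ._≥_ ps → All (_≤ suc k) ps →
                ∃₂ λ m ps′ → ps ≡ replicate m (suc k) ++ ps′ × Linked ℕ._≥_ ps′ × All (_≤ k) ps′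
split-largest k []       ps↘ _ = 0 , [] , refl , [] , []
split-largest k (p ∷ ps) ps↘ (p≤1+k ∷ ps≤1+k) with p ℕ.≟ suc k
... | yes refl with m , ps′ , refl , ps′↘ , ps′≤k ← split-largest k ps (Linked.tail ps↘) ps≤1+k
    = suc m , ps′ , refl , ps′↘ , ps′≤k
... | no p≢1+k = 0 , p ∷ ps , refl , ps↘ ,
      Linked⇒All (λ y≤x z≤y → ℕ.≤-trans z≤y y≤x) (ℕ.s≤s⁻¹ (ℕ.≤∧≢⇒< p≤1+k p≢1+k)) ps↘

module _ {a} {A : Set a} (z : A) {P : A → Set} (¬Pz : ¬ P z) where

  shift-elim : ∀ e f n → P (shift z e f n) → ∃ λ m → n ≡ e ℕ.+ m × P (f m)
  shift-elim zero    f n       p = n , refl , p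
  shift-elim (suc e) f zero    p = contradiction p ¬Pz
  shift-elim (suc e) f (suc n) p with m , refl , q ← shift-elim e f n p = m , refl , q

shift-+ : ∀ {a} {A : Set a} (z : A) e f m → shift z e f (e ℕ.+ m) ≡ f m
shift-+ z zero    f m = refl
shift-+ z (suc e) f m = shift-+ z e f m

shift-all : ∀ {a} {A : Set a} {z : A} (P : A → Set) → P z → ∀ e f n → (∀ m → P (f m)) → P (shift z e f n)
shift-all P pz zero    f n       pf = pf n
shift-all P pz (suc e) f zero    pf = pz
shift-all P pz (suc e) f (suc n) pf = shift-all P pz e f n pf

shift-natural : ∀ {a b} {A : Set a} {B : Set b} (g : A → B) z e f n →
                g (shift z e f n) ≡ shift (g z) e (g ∘ f) n
shift-natural g z zero    f n       = refl
shift-natural g z (suc e) f zero    = refl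
shift-natural g z (suc e) f (suc n) = shift-natural g z e f n

-- The recursion follows that of `∏`: the factor of the part k + 1 becomes a choice of its
-- multiplicity from `A (suc k)`. Prepending the largest part keeps the lists non-increasing.
build : (ℕ → List ℕ) → ℕ → ℕ → List (List ℕ)
prependCopies : (ℕ → List ℕ) → ℕ → ℕ → ℕ → List (List ℕ)

build A zero    zero    = [] ∷ []
build A zero    (suc n) = []
build A (suc k) n       = concatMap (prependCopies A k n) (A (suc k))

prependCopies A k n m = map (replicate m (suc k) ++_) (shift [] (m ℕ.* suc k) (build A k) n)

record PartitionWithin (A : ℕ → List ℕ) (k n : ℕ) (ps : List ℕ) : Set where
  constructor partitionWithin
  field
    isPartition : IsPartition n ps
    parts≤      : All (_≤ k) ps
    mult∈       : ∀ i → 1 ≤ i → i ≤ k → mult i ps ∈ A i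

module _ (A : ℕ → List ℕ) where

  ∈-prependCopies⁻ : ∀ k n m {ps} → ps ∈ prependCopies A k n m →
                     ∃₂ λ n′ ps′ → n ≡ m ℕ.* suc k ℕ.+ n′ × ps ≡ replicate m (suc k) ++ ps′ × ps′ ∈ build A k n′
  ∈-prependCopies⁻ k n m ps∈ with ps′ , ps′∈ , refl ← ∈-map⁻ _ ps∈
    with n′ , refl , ps′∈′ ← shift-elim [] {P = ps′ ∈_} (λ ()) (m ℕ.* suc k) (build A k) n ps′∈
    = n′ , ps′ , refl , refl , ps′∈′

  mult-prepended : ∀ k m {ps} → All (_≤ k) ps → mult (suc k) (replicate m (suc k) ++ ps) ≡ m
  mult-prepended k m {ps} ps≤k = begin
    mult (suc k) (replicate m (suc k) ++ ps)
      ≡⟨ mult-++ (suc k) (replicate m (suc k)) ps ⟩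
    mult (suc k) (replicate m (suc k)) ℕ.+ mult (suc k) ps
      ≡⟨ cong₂ ℕ._+_ (mult-replicate-≡ m (suc k)) (mult-above ps≤k ℕ.≤-refl) ⟩
    m ℕ.+ 0 ≡⟨ ℕ.+-identityʳ m ⟩
    m       ∎
    where open ≡-Reasoning

  mult-not-prepended : ∀ k m {i} ps → i ≤ k → mult i (replicate m (suc k) ++ ps) ≡ mult i ps
  mult-not-prepended k m {i} ps i≤k = trans (mult-++ i (replicate m (suc k)) ps)
    (cong (ℕ._+ mult i ps) (mult-replicate-≢ m (ℕ.<⇒≢ (s≤s i≤k))))

  ∈-build⁻ : ∀ k n {ps} → ps ∈ build A k n → PartitionWithin A k n ps
  ∈-build⁻ zero    zero    (here refl) = partitionWithin ([] , [] , refl) [] λ _ 1≤i i≤0 → contradiction (ℕ.≤-trans 1≤i i≤0) λ ()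
  ∈-build⁻ (suc k) n       ps∈
    with m , m∈A , ps∈′ ← find (∈-concatMap⁻ (prependCopies A k n) {xs = A (suc k)} ps∈)
    with n′ , ps′ , refl , refl , ps′∈ ← ∈-prependCopies⁻ k n m ps∈′
    with partitionWithin (1≤ps′ , ps′↘ , refl) ps′≤k mult′∈ ← ∈-build⁻ k n′ ps′∈
    = partitionWithin
      ( All.++⁺ (All.replicate⁺ m (s≤s z≤n)) 1≤ps′
      , linked-replicate-++ m ps′≤1+k ps′↘
      , trans (sum-++ (replicate m (suc k)) ps′) (cong (ℕ._+ sum ps′) (sum-replicate m (suc k))))
      (All.++⁺ (All.replicate⁺ m ℕ.≤-refl) ps′≤1+k)
      mult∈′
    where
    ps′≤1+k = All.map ℕ.m≤n⇒m≤1+n ps′≤k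
    mult∈′ : ∀ i → 1 ≤ i → i ≤ suc k → mult i (replicate m (suc k) ++ ps′) ∈ A i
    mult∈′ i 1≤i i≤1+k with i ℕ.≟ suc k
    ... | yes refl = subst (_∈ A i) (sym (mult-prepended k m ps′≤k)) m∈A
    ... | no i≢1+k = subst (_∈ A i) (sym (mult-not-prepended k m ps′ i≤k)) (mult′∈ i 1≤i i≤k)
      where i≤k = ℕ.s≤s⁻¹ (ℕ.≤∧≢⇒< i≤1+k i≢1+k)

  ∈-build⁺ : ∀ k n {ps} → PartitionWithin A k n ps → ps ∈ build A k n
  ∈-build⁺ zero n (partitionWithin (_ , _ , refl) [] _) = here refl
  ∈-build⁺ zero n (partitionWithin (1≤p ∷ _ , _) (p≤0 ∷ _) _) = contradiction (ℕ.≤-trans 1≤p p≤0) λ ()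
  ∈-build⁺ (suc k) n {ps} (partitionWithin (1≤ps , ps↘ , refl) ps≤1+k mult∈A)
    with m , ps′ , refl , ps′↘ , ps′≤k ← split-largest k ps ps↘ ps≤1+k
    = ∈-concatMap⁺ (prependCopies A k n) {xs = A (suc k)} (lose
        (subst (_∈ A (suc k)) (mult-prepended k m ps′≤k) (mult∈A (suc k) (s≤s z≤n) ℕ.≤-refl))
        (∈-map⁺ _ (subst (ps′ ∈_) (sym shift≡) (∈-build⁺ k (sum ps′) (partitionWithin
          (All.++⁻ʳ (replicate m (suc k)) 1≤ps , ps′↘ , refl) ps′≤k
          (λ i 1≤i i≤k → subst (_∈ A i) (mult-not-prepended k m ps′ i≤k)
            (mult∈A i 1≤i (ℕ.m≤n⇒m≤1+n i≤k))))))))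
    where
    shift≡ : shift [] (m ℕ.* suc k) (build A k) (sum (replicate m (suc k) ++ ps′)) ≡ build A k (sum ps′)
    shift≡ = trans (cong (shift [] (m ℕ.* suc k) (build A k))
        (trans (sum-++ (replicate m (suc k)) ps′) (cong (ℕ._+ sum ps′) (sum-replicate m (suc k)))))
      (shift-+ [] (m ℕ.* suc k) (build A k) (sum ps′))

unique-concatMap : ∀ {A B : Set} (f : A → List B) {xs} → (∀ x → Unique (f x)) →
                   AllPairs (λ x y → Disjoint (f x) (f y)) xs → Unique (concatMap f xs)
unique-concatMap f {xs} f-unique disjoint =
  Unique.concat⁺ (All.map⁺ (All.tabulate λ _ → f-unique _)) (AllPairs.map⁺ disjoint)

-- The multiplicity of k + 1 recovers the choice of m, so different choices give disjoint lists; for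
-- fixed m, prepending is injective.
unique-build : ∀ A → (∀ i → Unique (A i)) → ∀ k n → Unique (build A k n)
unique-build A A-unique zero    zero    = [] ∷ []
unique-build A A-unique zero    (suc n) = []
unique-build A A-unique (suc k) n       = unique-concatMap (prependCopies A k n)
  (λ m → Unique.map⁺ (++-cancelˡ (replicate m (suc k)) _ _)
    (shift-all Unique [] (m ℕ.* suc k) (build A k) n (unique-build A A-unique k)))
  (AllPairs.map disjoint (A-unique (suc k)))
  where
  mult-of : ∀ m {ps} → ps ∈ prependCopies A k n m → mult (suc k) ps ≡ m
  mult-of m ps∈ with n′ , ps′ , _ , refl , ps′∈ ← ∈-prependCopies⁻ A k n m ps∈
    = mult-prepended A k m (PartitionWithin.parts≤ (∈-build⁻ A k n′ ps′∈))
  disjoint : ∀ {m m′} → m ≢ m′ → Disjoint (prependCopies A k n m) (prependCopies A k n m′)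
  disjoint {m} {m′} m≢m′ (ps∈ , ps∈′) = m≢m′ (trans (sym (mult-of m ps∈)) (mult-of m′ ps∈′))

odd-length-concatMap : ∀ {A B : Set} (f : A → List B) xs →
  odd (length (concatMap f xs)) ≡ foldr (λ x b → odd (length (f x)) xor b) false xs
odd-length-concatMap f []       = refl
odd-length-concatMap f (x ∷ xs) = trans (cong odd (length-++ (f x)))
  (trans (odd-+ (length (f x)) _) (cong (odd (length (f x)) xor_) (odd-length-concatMap f xs)))

module _ (N : ℕ) where
  open Coefficients N

  -- Prepending m copies of k + 1 shifts the degree by m (k + 1), hence multiplies by that power of
  -- q, and concatenation over m becomes addition in F₂.
  odd-length-build : ∀ A k n → odd (length (build A k n)) ≡ ∏ (weight 𝕢 A) k n
  odd-length-build A zero    zero    = refl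
  odd-length-build A zero    (suc n) = refl
  odd-length-build A (suc k) n       = trans (odd-length-concatMap (prependCopies A k n) (A (suc k))) (go (A (suc k)))
    where
    term : ∀ m → odd (length (prependCopies A k n m)) ≡ (𝕢 ^ (m ℕ.* suc k) ⊛ ∏ (weight 𝕢 A) k) n
    term m = begin
      odd (length (prependCopies A k n m))
        ≡⟨ cong odd (length-map _ (shift [] (m ℕ.* suc k) (build A k) n)) ⟩
      odd (length (shift [] (m ℕ.* suc k) (build A k) n))
        ≡⟨ shift-natural (odd ∘ length) [] (m ℕ.* suc k) (build A k) n ⟩
      shift false (m ℕ.* suc k) (λ n′ → odd (length (build A k n′))) n
        ≡⟨ 𝕢^⊛ (m ℕ.* suc k) _ n ⟨
      (𝕢 ^ (m ℕ.* suc k) ⊛ (λ n′ → odd (length (build A k n′)))) n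
        ≡⟨ ⊛-cong n (λ _ _ → refl) (λ n′ _ → odd-length-build A k n′) ⟩
      (𝕢 ^ (m ℕ.* suc k) ⊛ ∏ (weight 𝕢 A) k) n ∎
      where open ≡-Reasoning
    -- At ms = `A (suc k)` the fold on the right is `weight 𝕢 A k`, the new factor of the product.
    go : ∀ ms → foldr (λ m b → odd (length (prependCopies A k n m)) xor b) false ms
              ≡ (foldr (λ m f → 𝕢 ^ (m ℕ.* suc k) ⊕ f) 𝟘 ms ⊛ ∏ (weight 𝕢 A) k) n
    go []       = sym (⊛-zeroˡ _ n)
    go (m ∷ ms) = trans (cong₂ _xor_ (term m) (go ms)) (sym (⊛-distribʳ _ (𝕢 ^ (m ℕ.* suc k)) _ n))

-- The partitions counted by c₁₀

odd⊎even : ∀ i → Odd i ⊎ Even i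
odd⊎even zero          = inj₂ refl
odd⊎even (suc zero)    = inj₁ refl
odd⊎even (suc (suc i)) = odd⊎even i

mult-suc : ∀ i ps → mult i (i ∷ ps) ≡ suc (mult i ps)
mult-suc i ps = cong length (filter-accept (i ℕ.≟_) refl)

mult-∷ : ∀ i p ps → mult i ps ≤ mult i (p ∷ ps)
mult-∷ i p ps = subst (mult i ps ≤_) (sym (mult-++ i (p ∷ []) ps)) (ℕ.m≤n+m (mult i ps) _)

∈⇒mult>0 : ∀ {i ps} → i ∈ ps → 0 < mult i ps
∈⇒mult>0 {i} {p ∷ ps} (here refl) = subst (0 <_) (sym (mult-suc i ps)) (s≤s z≤n)
∈⇒mult>0 {i} {p ∷ ps} (there i∈)  = ℕ.≤-trans (∈⇒mult>0 i∈) (mult-∷ i p ps)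

∉⇒mult≡0 : ∀ {i ps} → i ∉ ps → mult i ps ≡ 0
∉⇒mult≡0 {i} i∉ps = cong length (filter-none (i ℕ.≟_) (All.¬Any⇒All¬ _ i∉ps))

unique⇒mult≤1 : ∀ {ps} → Unique ps → ∀ i → mult i ps ≤ 1
unique⇒mult≤1 []                    i = z≤n
unique⇒mult≤1 {p ∷ ps} (p∉ps ∷ ps!) i with i ℕ.≟ p
... | yes refl = ℕ.≤-reflexive (trans (mult-suc i ps) (cong (suc ∘ length) (filter-none (i ℕ.≟_) p∉ps)))
... | no i≢p   = subst (_≤ 1) (cong length (sym (filter-reject (i ℕ.≟_) i≢p))) (unique⇒mult≤1 ps! i)

mult≤1⇒unique : ∀ ps → (∀ i → mult i ps ≤ 1) → Unique ps
mult≤1⇒unique []       _       = []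
mult≤1⇒unique (p ∷ ps) mult≤1 =
  All.¬Any⇒All¬ ps (λ p∈ps → ℕ.<⇒≱ (∈⇒mult>0 p∈ps)
    (ℕ.s≤s⁻¹ (subst (_≤ 1) (mult-suc p ps) (mult≤1 p))))
  ∷ mult≤1⇒unique ps (λ i → ℕ.≤-trans (mult-∷ i p ps) (mult≤1 i))

parts≤sum : ∀ ps → All (_≤ sum ps) ps
parts≤sum []       = []
parts≤sum (p ∷ ps) = ℕ.m≤m+n p (sum ps) ∷ All.map (λ le → ℕ.≤-trans le (ℕ.m≤n+m (sum ps) p)) (parts≤sum ps)

≤1⇒∈01 : ∀ {m} → m ≤ 1 → m ∈ 0 ∷ 1 ∷ []
≤1⇒∈01 z≤n       = here refl
≤1⇒∈01 (s≤s z≤n) = there (here refl)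

module _ (j i : ℕ) where

  allowed-≡ : ∀ f b → free j i ≡ f → base j i ≡ b →
              allowed j i ≡ (if f then b ∷ suc b ∷ [] else b ∷ [])
  allowed-≡ _ _ refl refl = refl

  low-odd : i ≤ j → Odd i → allowed j i ≡ 2 ∷ 3 ∷ []
  low-odd i≤j odd = allowed-≡ true 2 (free-odd j i odd) (base-≤ i≤j)

  low-even : i ≤ j → Even i → allowed j i ≡ 2 ∷ []
  low-even i≤j even = allowed-≡ false 2
    (trans (free-even j i even) (dec-false (2 ℕ.* j ℕ.<? i) (ℕ.≤⇒≯ (ℕ.≤-trans i≤j (ℕ.m≤n*m j 2)))))
    (base-≤ i≤j)

  high-odd : j < i → Odd i → allowed j i ≡ 0 ∷ 1 ∷ []
  high-odd j<i odd = allowed-≡ true 0 (free-odd j i odd) (base-> j<i)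

  gap-even : j < i → Even i → i ≤ 2 ℕ.* j → allowed j i ≡ 0 ∷ []
  gap-even j<i even i≤2j = allowed-≡ false 0
    (trans (free-even j i even) (dec-false (2 ℕ.* j ℕ.<? i) (ℕ.≤⇒≯ i≤2j))) (base-> j<i)

  high-even : Even i → 2 ℕ.* j < i → allowed j i ≡ 0 ∷ 1 ∷ []
  high-even even 2j<i = allowed-≡ true 0
    (trans (free-even j i even) (dec-true (2 ℕ.* j ℕ.<? i) 2j<i))
    (base-> (ℕ.≤-<-trans (ℕ.m≤n*m j 2) 2j<i))

  ∈-allowed⇒bounds : ∀ {m} → m ∈ allowed j i → base j i ≤ m × m ≤ suc (base j i)
  ∈-allowed⇒bounds m∈ with free j i | m∈
  ... | true  | here refl         = ℕ.≤-refl , ℕ.n≤1+n _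
  ... | true  | there (here refl) = ℕ.n≤1+n _ , ℕ.≤-refl
  ... | false | here refl         = ℕ.≤-refl , ℕ.n≤1+n _

  unique-allowed : Unique (allowed j i)
  unique-allowed with free j i
  ... | true  = (ℕ.<⇒≢ (ℕ.n<1+n _) ∷ []) ∷ [] ∷ []
  ... | false = [] ∷ []

allowed-0 : ∀ i → 1 ≤ i → allowed 0 i ≡ 0 ∷ 1 ∷ []
allowed-0 i 1≤i with odd⊎even i
... | inj₁ odd  = high-odd 0 i 1≤i odd
... | inj₂ even = high-even 0 i even 1≤i

distinct⇒allowed : ∀ {ps} → Unique ps → ∀ i → 1 ≤ i → mult i ps ∈ allowed 0 i
distinct⇒allowed {ps} ps! i 1≤i =
  subst (mult i ps ∈_) (sym (allowed-0 i 1≤i)) (≤1⇒∈01 (unique⇒mult≤1 ps! i))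

condB⇒allowed : ∀ {j ps} → CondB j ps → ∀ i → 1 ≤ i → mult i ps ∈ allowed j i
condB⇒allowed {j} {ps} (_ , low , high , gap , top) i 1≤i with i ℕ.≤? j | odd⊎even i
... | yes i≤j | inj₁ odd = subst (mult i ps ∈_) (sym (low-odd j i i≤j odd)) (2or3 (proj₁ (low i 1≤i i≤j) odd))
  where
  2or3 : ∀ {m} → m ≡ 2 ⊎ m ≡ 3 → m ∈ 2 ∷ 3 ∷ []
  2or3 (inj₁ refl) = here refl
  2or3 (inj₂ refl) = there (here refl)
... | yes i≤j | inj₂ even = subst (mult i ps ∈_) (sym (low-even j i i≤j even)) (here (proj₂ (low i 1≤i i≤j) even))
... | no i≰j | inj₁ odd = subst (mult i ps ∈_) (sym (high-odd j i (ℕ.≰⇒> i≰j) odd)) (≤1⇒∈01 (high i odd (ℕ.≰⇒> i≰j)))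
... | no i≰j | inj₂ even with i ℕ.≤? 2 ℕ.* j
... | yes i≤2j = subst (mult i ps ∈_) (sym (gap-even j i (ℕ.≰⇒> i≰j) even i≤2j))
                   (here (∉⇒mult≡0 (gap i even (ℕ.≰⇒> i≰j) i≤2j)))
... | no i≰2j = subst (mult i ps ∈_) (sym (high-even j i even (ℕ.≰⇒> i≰2j))) (≤1⇒∈01 (top i even (ℕ.≰⇒> i≰2j)))

-- Even, so that products over all parts split into odd and even factors.
maxPart : ℕ → ℕ
maxPart n = n ℕ.* 2

n≤maxPart : ∀ n → n ≤ maxPart n
n≤maxPart n = ℕ.m≤m*n n 2

c10-list : ℕ → List (List ℕ)
c10-list n = concatMap (λ j → build (allowed j) (maxPart n) n) (downFrom (suc n))

partition-parts≤ : ∀ {n ps} → IsPartition n ps → All (_≤ n) ps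
partition-parts≤ {ps = ps} (_ , _ , refl) = parts≤sum ps

-- The part j itself must occur at least twice, so it cannot exceed n. Hence the range of j in
-- `c10-list` is large enough.
condB⇒j≤n : ∀ {n j ps} → IsPartition n ps → CondB j ps → j ≤ n
condB⇒j≤n {n} {j} {ps} part condB@(1≤j , _) with j ℕ.≤? n
... | yes j≤n = j≤n
... | no j≰n with () ← ℕ.≤-trans
      (subst (_≤ mult j ps) (base-≤ {j} {j} ℕ.≤-refl) (proj₁ (∈-allowed⇒bounds j j (condB⇒allowed condB j 1≤j))))
      (ℕ.≤-reflexive (mult-above (partition-parts≤ part) (ℕ.≰⇒> j≰n)))

module _ {n j ps} (j≤n : j ≤ n) (within : PartitionWithin (allowed j) (maxPart n) n ps) where
  open PartitionWithin within

  mult-≤1 : ∀ {i} → (1 ≤ i → mult i ps ∈ allowed j i) → j < i → mult i ps ≤ 1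
  mult-≤1 {i} m∈ j<i = subst (mult i ps ≤_) (cong suc (base-> j<i))
    (proj₂ (∈-allowed⇒bounds j i (m∈ (ℕ.≤-trans (s≤s z≤n) j<i))))

  within⇒mult≤1 : ∀ i → j < i → mult i ps ≤ 1
  within⇒mult≤1 i j<i with i ℕ.≤? maxPart n
  ... | yes i≤K = mult-≤1 (λ 1≤i → mult∈ i 1≤i i≤K) j<i
  ... | no  i≰K = ℕ.≤-trans (ℕ.≤-reflexive (mult-above parts≤ (ℕ.≰⇒> i≰K))) z≤n

  within⇒condB : 1 ≤ j → CondB j ps
  within⇒condB 1≤j = 1≤j
    , (λ i 1≤i i≤j →
        let m∈ = mult∈ i 1≤i (ℕ.≤-trans i≤j (ℕ.≤-trans j≤n (n≤maxPart n))) in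
        (λ odd → 2or3 (subst (mult i ps ∈_) (low-odd j i i≤j odd) m∈))
      , (λ even → only (subst (mult i ps ∈_) (low-even j i i≤j even) m∈)))
    , (λ p _ j<p → within⇒mult≤1 p j<p)
    -- The bound e ≤ 2j ≤ 2n = `maxPart n` puts e in the range of `mult∈`.
    , (λ e even j<e e≤2j e∈ps → ℕ.<⇒≢ (∈⇒mult>0 e∈ps)
        (sym (only (subst (mult e ps ∈_) (gap-even j e j<e even e≤2j)
          (mult∈ e (ℕ.≤-trans (s≤s z≤n) j<e) (ℕ.≤-trans e≤2j
            (ℕ.≤-trans (ℕ.*-monoʳ-≤ 2 j≤n) (ℕ.≤-reflexive (ℕ.*-comm 2 n)))))))))
    , (λ e _ 2j<e → within⇒mult≤1 e (ℕ.≤-<-trans (ℕ.m≤n*m j 2) 2j<e))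
    where
    only : ∀ {m x : ℕ} → m ∈ x ∷ [] → m ≡ x
    only (here eq) = eq
    2or3 : ∀ {m} → m ∈ 2 ∷ 3 ∷ [] → m ≡ 2 ⊎ m ≡ 3
    2or3 (here eq)         = inj₁ eq
    2or3 (there (here eq)) = inj₂ eq

within⇒c10 : ∀ {n} j {ps} → j ≤ n → PartitionWithin (allowed j) (maxPart n) n ps → C10 ps
within⇒c10 {n} (suc j) j≤n within = inj₂ (suc j , within⇒condB j≤n within (s≤s z≤n))
within⇒c10 {n} zero {ps} j≤n within = inj₁ (mult≤1⇒unique ps mult≤1)
  where
  mult≤1 : ∀ i → mult i ps ≤ 1
  mult≤1 (suc i) = within⇒mult≤1 j≤n within (suc i) (s≤s z≤n)
  -- The lists `allowed` say nothing about the entry 0; the positivity of the parts excludes it.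
  mult≤1 zero    = ℕ.≤-trans (ℕ.≤-reflexive (∉⇒mult≡0
    (λ 0∈ → contradiction (All.lookup (proj₁ (PartitionWithin.isPartition within)) 0∈) λ ()))) z≤n

c10⇒∈ : ∀ n j {ps} → j ≤ n → IsPartition n ps → (∀ i → 1 ≤ i → mult i ps ∈ allowed j i) → ps ∈ c10-list n
c10⇒∈ n j j≤n part mult∈ = ∈-concatMap⁺ (λ j → build (allowed j) (maxPart n) n) {xs = downFrom (suc n)}
  (lose (∈-downFrom⁺ (s≤s j≤n)) (∈-build⁺ (allowed j) (maxPart n) n (partitionWithin part
    (All.map (λ p≤n → ℕ.≤-trans p≤n (n≤maxPart n)) (partition-parts≤ part))
    (λ i 1≤i _ → mult∈ i 1≤i))))

∈-c10-list : ∀ n ps → (ps ∈ c10-list n) ⇔ (IsPartition n ps × C10 ps)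
∈-c10-list n ps = mk⇔ to from
  where
  to : ps ∈ c10-list n → IsPartition n ps × C10 ps
  to ps∈ with j , j∈ , ps∈′ ← find (∈-concatMap⁻ (λ j → build (allowed j) (maxPart n) n) {xs = downFrom (suc n)} ps∈)
    = let within = ∈-build⁻ (allowed j) (maxPart n) n ps∈′ in
      PartitionWithin.isPartition within , within⇒c10 j (ℕ.s≤s⁻¹ (∈-downFrom⁻ j∈)) within
  from : IsPartition n ps × C10 ps → ps ∈ c10-list n
  from (part , inj₁ ps!)         = c10⇒∈ n 0 z≤n part (distinct⇒allowed ps!)
  from (part , inj₂ (j , condB)) = c10⇒∈ n j (condB⇒j≤n part condB) part (condB⇒allowed condB)

-- For j < j′ the part j + 1 occurs at least twice under j′ and at most once under j, so no
-- partition is listed for two parameters. With j = 0 this also separates case (a) from case (b).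
unique-c10-list : ∀ n → Unique (c10-list n)
unique-c10-list n = unique-concatMap _
  (λ j → unique-build (allowed j) (unique-allowed j) (maxPart n) n)
  (AllPairs.applyDownFrom⁺₁ id (suc n) disjoint)
  where
  disjoint : ∀ {j′ j} → j < j′ → j′ < suc n →
             Disjoint (build (allowed j′) (maxPart n) n) (build (allowed j) (maxPart n) n)
  disjoint {j′} {j} j<j′ (s≤s j′≤n) {ps} (ps∈′ , ps∈) = ℕ.<-irrefl refl (ℕ.≤-trans
    (subst (_≤ mult (suc j) ps) (base-≤ j<j′) (proj₁ (∈-allowed⇒bounds j′ (suc j)
      (PartitionWithin.mult∈ (∈-build⁻ (allowed j′) (maxPart n) n ps∈′) (suc j) (s≤s z≤n)
        (ℕ.≤-trans j<j′ (ℕ.≤-trans j′≤n (n≤maxPart n)))))))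
    (within⇒mult≤1 (ℕ.<⇒≤ (ℕ.≤-trans j<j′ j′≤n)) (∈-build⁻ (allowed j) (maxPart n) n ps∈) (suc j) ℕ.≤-refl))

-- The truncation degree is n itself, so coefficient n is the last one that survives, and j ≤ n is
-- the range of both the list and the sum.
odd-length-c10-list : ∀ n → odd (length (c10-list n)) ≡ Coefficients.θ n 𝕢 (suc (maxPart n)) n
odd-length-c10-list n = trans (go (suc n)) (Σ<-weight-allowed≈θ 𝕢 n 𝕢^suc[N]≈0 n ℕ.≤-refl)
  where
  open Coefficients n
  go : ∀ J → odd (length (concatMap (λ j → build (allowed j) (maxPart n) n) (downFrom J)))
           ≡ Σ< (λ j → ∏ (weight 𝕢 (allowed j)) (maxPart n)) J n
  go zero    = refl
  go (suc J) = trans (cong odd (length-++ (build (allowed J) (maxPart n) n)))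
    (trans (odd-+ (length (build (allowed J) (maxPart n) n)) _)
      (cong₂ _xor_ (odd-length-build n (allowed J) (maxPart n) n) (go J)))

-- Triangular numbers as the values of 2j² + j

tri-mono-< : ∀ {i j} → i < j → tri i < tri j
tri-mono-< {i} {suc j} (s≤s i≤j) = s≤s (ℕ.≤-trans (tri-mono-≤ i≤j) (ℕ.m≤n+m (tri j) j))
  where
  tri-mono-≤ : ∀ {i j} → i ≤ j → tri i ≤ tri j
  tri-mono-≤ z≤n       = z≤n
  tri-mono-≤ (s≤s i≤j) = ℕ.+-mono-≤ (s≤s i≤j) (tri-mono-≤ i≤j)

n≤tri : ∀ n → n ≤ tri n
n≤tri zero    = z≤n
n≤tri (suc n) = ℕ.m≤m+n (suc n) (tri n)

open import Data.Integer using (+_)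

quadratic-nonNeg : ∀ s → (+ 2) ℤ.* + s ℤ.* + s ℤ.+ + s ≡ + tri (s ℕ.* 2)
quadratic-nonNeg s = begin
  (+ 2) ℤ.* + s ℤ.* + s ℤ.+ + s ≡⟨ cong (λ x → x ℤ.* + s ℤ.+ + s) (ℤ.pos-* 2 s) ⟨
  + (2 ℕ.* s) ℤ.* + s ℤ.+ + s   ≡⟨ cong (ℤ._+ + s) (ℤ.pos-* (2 ℕ.* s) s) ⟨
  + (2 ℕ.* s ℕ.* s ℕ.+ s)
    ≡⟨ cong +_ (solve 1 (λ s → con 2 :* s :* s :+ s := (con 1 :+ s :* con 2) :* s) refl s) ⟩
  + (suc (s ℕ.* 2) ℕ.* s)       ≡⟨ cong +_ (tri-even s) ⟨
  + tri (s ℕ.* 2)               ∎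
  where
  open ≡-Reasoning
  open +-*-Solver

-- At j = -(s + 1) the value is 2(s + 1)² - (s + 1) = (2s + 1)(s + 1). So negative j account for the
-- triangular numbers of odd index, and nonnegative j for those of even index.
quadratic-neg : ∀ s → (+ 2) ℤ.* -[1+ s ] ℤ.* -[1+ s ] ℤ.+ -[1+ s ] ≡ + tri (suc (s ℕ.* 2))
quadratic-neg s = begin
  (+ 2) ℤ.* -[1+ s ] ℤ.* -[1+ s ] ℤ.+ -[1+ s ] ≡⟨⟩
  (2 ℕ.* suc s ℕ.* suc s) ℤ.⊖ suc s
    ≡⟨ cong (ℤ._⊖ suc s) (solve 1 (λ s → con 2 :* (con 1 :+ s) :* (con 1 :+ s)
         := (con 1 :+ s :* con 2) :* (con 1 :+ s) :+ (con 1 :+ s)) refl s) ⟩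
  (m ℕ.+ suc s) ℤ.⊖ suc s       ≡⟨ ℤ.⊖-≥ (ℕ.m≤n+m (suc s) m) ⟩
  + (m ℕ.+ suc s ℕ.∸ suc s)     ≡⟨ cong +_ (ℕ.m+n∸n≡m m (suc s)) ⟩
  + m                           ≡⟨ cong +_ (tri-odd s) ⟨
  + tri (suc (s ℕ.* 2))         ∎
  where
  open ≡-Reasoning
  open +-*-Solver
  m = suc (s ℕ.* 2) ℕ.* suc s

genPent⇒tri : ∀ {n} → IsGenPent n → ∃ λ k → tri k ≡ n
genPent⇒tri (+ s , eq)      = s ℕ.* 2 , sym (ℤ.+-injective (trans eq (quadratic-nonNeg s)))
genPent⇒tri (-[1+ s ] , eq) = suc (s ℕ.* 2) , sym (ℤ.+-injective (trans eq (quadratic-neg s)))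

half : ∀ k → ∃ λ s → k ≡ s ℕ.* 2 ⊎ k ≡ suc (s ℕ.* 2)
half zero          = 0 , inj₁ refl
half (suc zero)    = 0 , inj₂ refl
half (suc (suc k)) with half k
... | s , inj₁ refl = suc s , inj₁ refl
... | s , inj₂ refl = suc s , inj₂ refl

tri-genPent : ∀ k → IsGenPent (tri k)
tri-genPent k with half k
... | s , inj₁ refl = + s , sym (quadratic-nonNeg s)
... | s , inj₂ refl = -[1+ s ] , sym (quadratic-neg s)

theorem11 : (n : ℕ) → Σ (List (List ℕ)) (λ L → C10List n L ×
    (IsGenPent n → length L % 2 ≡ 1) × (¬ IsGenPent n → length L % 2 ≡ 0))
theorem11 n = c10-list n , (unique-c10-list n , ∈-c10-list n) ,
  (λ pent → parity (on (genPent⇒tri pent))) ,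
  (λ ¬pent → parity (Σ<-off-support tri (suc (maxPart n)) n (λ k _ eq → ¬pent (subst IsGenPent eq (tri-genPent k)))))
  where
  open Coefficients n
  parity : ∀ {b} → θ 𝕢 (suc (maxPart n)) n ≡ b → length (c10-list n) ℕ.% 2 ≡ (if b then 1 else 0)
  parity {b} eq = trans (odd-%2 (length (c10-list n)))
    (cong (λ b → if b then 1 else 0) (trans (odd-length-c10-list n) eq))
  on : (∃ λ k → tri k ≡ n) → θ 𝕢 (suc (maxPart n)) n ≡ true
  on (k , eq) = subst (λ m → θ 𝕢 (suc (maxPart n)) m ≡ true) eq
    -- From k ≤ tri k = n ≤ 2n it follows that the summand k is among the 2n + 1 summands of `θ`.
    (Σ<-on-support tri tri-mono-< (suc (maxPart n)) k
      (s≤s (ℕ.≤-trans (ℕ.≤-trans (n≤tri k) (ℕ.≤-reflexive eq)) (n≤maxPart n))))
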